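{- The set of first order sentences $\varphi$ (in the language of graphs) such that $G(n\mid\varphi)$ obeys the FO 0--1 law is not recursively enumerable.
   Context: For a first order sentence $\varphi$ over the signature $\{=,\sim\}$, $G(n\mid\varphi)$ is a graph chosen uniformly at random from all simple undirected loopless graphs on $[n]$ satisfying $\varphi$. $G(n\mid\varphi)$ obeys the FO 0--1 law if for every first order sentence $\psi$, $\Pr(G(n\mid\varphi)\models\psi)$ converges to $0$ or to $1$ as $n\to\infty$. The decision problem takes a FO sentence $\varphi$ as input. -}

module Defs where

open import Data.Nat using (ℕ; zero; suc; _+_; _*_; _≤_; _<_)
open import Data.Bool using (Bool; true; false; not; _∧_; if_then_else_)
open import Data.Fin using (Fin; zero; suc)
import Data.Fin as Fin
open import Data.Vec using (Vec; []; _∷_; lookup)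
open import Data.List using (List; []; _∷_; length; filterᵇ; concatMap; allFin; map)
open import Data.Bool.ListAction using (any)
open import Data.Sum using (_⊎_)
open import Data.Maybe using (Maybe; just; nothing)
open import Data.Product using (_×_; _,_; Σ; ∃)
open import Data.Unit using (⊤; tt)
open import Relation.Nullary.Decidable using (⌊_⌋)
open import Relation.Binary.PropositionalEquality using (_≡_)
open import Function.Bundles using (_⇔_)

data Fm : Set where
  eqv  : ℕ → ℕ → Fm
  adj  : ℕ → ℕ → Fm
  neg  : Fm → Fm
  conj : Fm → Fm → Fm
  ex   : Fm → Fm             -- ∃ (binds de Bruijn index 0)

WellScoped : ℕ → Fm → Set
WellScoped k (eqv i j)  = (i < k) × (j < k)
WellScoped k (adj i j)  = (i < k) × (j < k)
WellScoped k (neg φ)    = WellScoped k φ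
WellScoped k (conj φ ψ) = WellScoped k φ × WellScoped k ψ
WellScoped k (ex φ)     = WellScoped (suc k) φ

Sentence : Fm → Set
Sentence = WellScoped 0

-- Simple undirected loopless graphs on the vertex set Fin n.
-- A graph on n+1 vertices = a graph on the vertices 1..n together with
-- the neighbourhood (a bit vector) of vertex 0 among them.
-- This is a bijective encoding of labelled simple graphs on [n].

Graph : ℕ → Set
Graph zero    = ⊤
Graph (suc n) = Graph n × Vec Bool n

edge : ∀ {n} → Graph n → Fin n → Fin n → Bool
edge {suc n} (g , v) zero    zero    = false
edge {suc n} (g , v) zero    (suc j) = lookup v j
edge {suc n} (g , v) (suc i) zero    = lookup v i
edge {suc n} (g , v) (suc i) (suc j) = edge g i j

allVecs : (m : ℕ) → List (Vec Bool m)
allVecs zero    = [] ∷ []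
allVecs (suc m) = concatMap (λ v → (true ∷ v) ∷ (false ∷ v) ∷ []) (allVecs m)

allGraphs : (n : ℕ) → List (Graph n)
allGraphs zero    = tt ∷ []
allGraphs (suc n) = concatMap (λ g → map (λ v → (g , v)) (allVecs n)) (allGraphs n)

nth : ∀ {A : Set} → List A → ℕ → Maybe A
nth []       _       = nothing
nth (x ∷ xs) zero    = just x
nth (x ∷ xs) (suc i) = nth xs i

atomEq : ∀ {n} → Maybe (Fin n) → Maybe (Fin n) → Bool
atomEq (just a) (just b) = ⌊ a Fin.≟ b ⌋
atomEq _        _        = false

atomAdj : ∀ {n} → Graph n → Maybe (Fin n) → Maybe (Fin n) → Bool
atomAdj g (just a) (just b) = edge g a b
atomAdj g _        _        = false

sat : ∀ {n} → Graph n → List (Fin n) → Fm → Bool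
sat g ρ (eqv i j)  = atomEq (nth ρ i) (nth ρ j)
sat g ρ (adj i j)  = atomAdj g (nth ρ i) (nth ρ j)
sat g ρ (neg φ)    = not (sat g ρ φ)
sat g ρ (conj φ ψ) = sat g ρ φ ∧ sat g ρ ψ
sat {n} g ρ (ex φ) = any (λ a → sat g (a ∷ ρ) φ) (allFin n)

_⊨_ : ∀ {n} → Graph n → Fm → Bool
g ⊨ φ = sat g [] φ

count : ℕ → Fm → ℕ
count n φ = length (filterᵇ (λ g → g ⊨ φ) (allGraphs n))

-- Pr(G(n|φ) ⊨ ψ) = count n (φ ∧ ψ) / count n φ.
-- "converges to 0": for every k ≥ 1, eventually Pr ≤ 1/k;
-- "converges to 1": for every k ≥ 1, eventually Pr(¬ψ) ≤ 1/k.
-- We also require G(n|φ) to be defined (count n φ > 0) for all large n.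

EventuallyDefined : Fm → Set
EventuallyDefined φ = ∃ λ N → ∀ n → N ≤ n → 0 < count n φ

TendsToZero : Fm → Fm → Set
TendsToZero φ ψ = ∀ k → 1 ≤ k → ∃ λ N → ∀ n → N ≤ n →
  k * count n (conj φ ψ) ≤ count n φ

TendsToOne : Fm → Fm → Set
TendsToOne φ ψ = TendsToZero φ (neg ψ)

ZeroOneLaw : Fm → Set
ZeroOneLaw φ = EventuallyDefined φ ×
  (∀ ψ → Sentence ψ → TendsToZero φ ψ ⊎ TendsToOne φ ψ)

-- Gödel numbering of formulas (Cantor pairing)

tri : ℕ → ℕ
tri zero    = 0
tri (suc n) = suc n + tri n

pair : ℕ → ℕ → ℕ
pair a b = tri (a + b) + b

code : Fm → ℕ
code (eqv i j)  = pair 0 (pair i j)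
code (adj i j)  = pair 1 (pair i j)
code (neg φ)    = pair 2 (code φ)
code (conj φ ψ) = pair 3 (pair (code φ) (code ψ))
code (ex φ)     = pair 4 (code φ)

data PR : ℕ → Set where
  zer  : ∀ {k} → PR k
  succ : PR 1
  proj : ∀ {k} → Fin k → PR k
  comp : ∀ {m k} → PR m → Vec (PR k) m → PR k
  prec : ∀ {k} → PR k → PR (suc (suc k)) → PR (suc k)

mutual
  eval : ∀ {k} → PR k → Vec ℕ k → ℕ
  eval zer        xs       = 0
  eval succ       (x ∷ []) = suc x
  eval (proj i)   xs       = lookup xs i
  eval (comp f gs) xs      = eval f (evalAll gs xs)
  eval (prec f g) (x ∷ xs) = iter x
    where
    iter : ℕ → ℕ
    iter zero    = eval f xs
    iter (suc n) = eval g (n ∷ iter n ∷ xs)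

  evalAll : ∀ {m k} → Vec (PR k) m → Vec ℕ k → Vec ℕ m
  evalAll []       xs = []
  evalAll (g ∷ gs) xs = eval g xs ∷ evalAll gs xs

-- S ⊆ ℕ is recursively enumerable iff S = {x | ∃ t. R(x,t) = 0}
-- for some primitive recursive R (Kleene normal form / Σ⁰₁).
RecEnum : (ℕ → Set) → Set
RecEnum S = Σ (PR 2) λ R → ∀ x → (S x ⇔ (∃ λ t → eval R (x ∷ t ∷ []) ≡ 0))

ZeroOneCodes : ℕ → Set
ZeroOneCodes x = ∃ λ φ → Sentence φ × ZeroOneLaw φ × (code φ ≡ x)

{-# OPTIONS --safe #-}
module Submission where

-- Given a primitive recursive R, a sentence ψ is built which says "the graph is edgeless, or it
-- has even order and contains a computation of R (⌜ψ⌝ , t) = 0 for some t".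
-- If R (⌜ψ⌝ , t) ≠ 0 for all t, the models of ψ are the edgeless graphs, whose first-order theory
-- stabilises, so ψ obeys the 0–1 law. If R (⌜ψ⌝ , t) = 0 for some t, the edgeless graph is the
-- only model of ψ at odd orders, while at infinitely many even orders there is another one; as
-- there is one edgeless graph per order, "edgeless" has probability 1 at odd orders and at most
-- 1/2 at infinitely many even ones. Hence ψ obeys the law iff R (⌜ψ⌝ , t) ≠ 0 for all t, so R does
-- not enumerate the sentences obeying it.
--
-- Vertices serve as numbers: strict inclusion of neighbourhoods is a well-founded order in every
-- finite graph, and v is the successor of u when u is the largest vertex below v. Primitive
-- recursive terms are then translated into formulas by structural recursion, a recursion being
-- witnessed by a pair of vertices that codes the sequence of its intermediate values. Local
-- correctness of that sequence suffices, so soundness holds in every graph without any axiom.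

open import Defs
open import Relation.Nullary using (¬_)
open import Data.Bool using (Bool; true; false; not; _∧_; T)
open import Data.Bool.ListAction using (any)
import Data.Bool.Properties as Bool
open import Data.Bool.Properties using (T-∧; T?)
open import Data.Empty using (⊥; ⊥-elim)
open import Data.Fin using (Fin; zero; suc; toℕ; fromℕ<; finToFun; funToFin; _↑ˡ_; _↑ʳ_)
import Data.Fin as Fin
import Data.Fin.Properties as Fin
open import Data.Fin.Induction using (spo-wellFounded)
open import Data.Fin.Patterns
open import Data.Fin.Permutation using (Permutation′; permutation)
open import Data.List using (List; []; _∷_; length; filterᵇ; concatMap)
import Data.List as List
open import Data.List.Properties using (filter-some; filter-none)
import Data.List.Membership.DecPropositional as DecMembership
open import Data.List.Membership.Propositional using (_∈_; find; lose)
open import Data.List.Membership.Propositional.Properties using (∈-allFin; ∈-map⁺; ∈-map⁻; ∈-concatMap⁺; ∈-filter⁻)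
open import Data.List.Relation.Unary.All using ([]; _∷_)
import Data.List.Relation.Unary.All as All
import Data.List.Relation.Unary.All.Properties as All
open import Data.List.Relation.Unary.AllPairs using ([]; _∷_)
import Data.List.Relation.Unary.AllPairs as AllPairs
import Data.List.Relation.Unary.AllPairs.Properties as AllPairs
open import Data.List.Relation.Unary.Any using (here; there; index)
open import Data.List.Relation.Unary.Any.Properties using (any⁺; any⁻; lookup-index)
open import Data.List.Relation.Unary.Unique.Propositional using (Unique)
import Data.List.Relation.Unary.Unique.Propositional.Properties as Unique
open import Data.Maybe using (Maybe; just; nothing)
import Data.Maybe.Properties as Maybe
open import Data.Nat using (ℕ; zero; suc; _+_; _*_; _^_; _⊔_; _≤_; _<_; z≤n; s≤s)
open import Data.Nat.Properties
open import Data.Product using (_×_; _,_; proj₁; proj₂; ∃)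
open import Data.Product.Function.NonDependent.Propositional using (_×-↔_)
import Data.Product.Properties as Product
open import Data.Sum using (_⊎_; inj₁; inj₂; swap)
open import Data.Sum.Function.Propositional using (_⊎-↔_)
import Data.Sum.Properties as Sum
open import Data.Unit using (⊤; tt)
import Data.Unit.Properties as Unit
open import Data.Vec using (Vec; []; _∷_; lookup; toList; tabulate; _++_; map; allFin)
import Data.Vec as Vec
import Data.Vec.Properties as Vec
open import Data.Vec.Relation.Binary.Pointwise.Inductive using (Pointwise; []; _∷_)
import Data.Vec.Relation.Binary.Pointwise.Inductive as Pointwise
open import Function using (_∘_; _⇔_; mk⇔; Equivalence; Inverse; _↔_; case_of_)
open import Function.Construct.Composition using (_↔-∘_)
open import Function.Construct.Identity using (↔-id)
open import Induction.WellFounded using (WellFounded; Acc; acc)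
open import Relation.Binary.Definitions using (DecidableEquality; tri<; tri≈; tri>)
open import Relation.Binary.PropositionalEquality
open import Relation.Nullary using (Dec; yes; no; does; proof; Reflects; ofʸ; ofⁿ; _because_)
open import Relation.Nullary.Decidable using (_⊎-dec_; dec-true; dec-false; isYes≗does)
open import Relation.Nullary.Reflects using (¬-reflects; _×-reflects_; T-reflects; fromEquivalence)
open import Algebra.Properties.CommutativeMonoid.Sum +-0-commutativeMonoid using (sum; sum-permute; ∑-distrib-+; sum-cong-≗)
open Equivalence using (to; from)

-- Gödel numbers and the diagonal function

tri-mono : ∀ {m n} → m ≤ n → tri m ≤ tri n
tri-mono z≤n       = z≤n
tri-mono (s≤s m≤n) = +-mono-≤ (s≤s m≤n) (tri-mono m≤n)

-- As `b < suc (a + b)`, a pair on one antidiagonal stays below `tri (suc (a + b))`, where the next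
-- one starts.
pair-mono-< : ∀ {a b a′ b′} → a + b < a′ + b′ → pair a b < pair a′ b′
pair-mono-< {a} {b} {a′} {b′} lt = begin-strict
  tri (a + b) + b             <⟨ +-monoʳ-< (tri (a + b)) (s≤s (m≤n+m b a)) ⟩
  tri (a + b) + suc (a + b)   ≡⟨ +-comm (tri (a + b)) _ ⟩
  tri (suc (a + b))           ≤⟨ tri-mono lt ⟩
  tri (a′ + b′)               ≤⟨ m≤m+n _ b′ ⟩
  tri (a′ + b′) + b′          ∎
  where open ≤-Reasoning

pair-injective : ∀ a b a′ b′ → pair a b ≡ pair a′ b′ → a ≡ a′ × b ≡ b′
pair-injective a b a′ b′ eq with <-cmp (a + b) (a′ + b′)
... | tri< lt _ _ = ⊥-elim (<⇒≢ (pair-mono-< {a} {b} {a′} {b′} lt) eq)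
... | tri> _ _ gt = ⊥-elim (<⇒≢ (pair-mono-< {a′} {b′} {a} {b} gt) (sym eq))
... | tri≈ _ s≡s′ _ = +-cancelʳ-≡ b a a′ (trans s≡s′ (cong (a′ +_) (sym b≡b′))) , b≡b′
  where
  b≡b′ : b ≡ b′
  b≡b′ = +-cancelˡ-≡ (tri (a + b)) b b′ (trans eq (cong (λ s → tri s + b′) (sym s≡s′)))

-- Splitting `code` into a tag and a payload lets one use of `pair-injective` serve all pairs of
-- constructors: different tags are absurd, and `body-injective` treats equal ones.
tag : Fm → ℕ
tag (eqv i j)  = 0
tag (adj i j)  = 1
tag (neg φ)    = 2
tag (conj φ ψ) = 3
tag (ex φ)     = 4

body : Fm → ℕ
body (eqv i j)  = pair i j
body (adj i j)  = pair i j
body (neg φ)    = code φ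
body (conj φ ψ) = pair (code φ) (code ψ)
body (ex φ)     = code φ

code-tag-body : ∀ φ → code φ ≡ pair (tag φ) (body φ)
code-tag-body (eqv i j)  = refl
code-tag-body (adj i j)  = refl
code-tag-body (neg φ)    = refl
code-tag-body (conj φ ψ) = refl
code-tag-body (ex φ)     = refl

code-injective : ∀ φ ψ → code φ ≡ code ψ → φ ≡ ψ
body-injective : ∀ φ ψ → tag φ ≡ tag ψ → body φ ≡ body ψ → φ ≡ ψ

code-injective φ ψ eq
  with pair-injective (tag φ) (body φ) (tag ψ) (body ψ)
         (trans (sym (code-tag-body φ)) (trans eq (code-tag-body ψ)))
... | tag≡ , body≡ = body-injective φ ψ tag≡ body≡

body-injective (eqv i j) (eqv i′ j′) _ eq =
  cong₂ eqv (proj₁ (pair-injective i j i′ j′ eq)) (proj₂ (pair-injective i j i′ j′ eq))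
body-injective (adj i j) (adj i′ j′) _ eq =
  cong₂ adj (proj₁ (pair-injective i j i′ j′ eq)) (proj₂ (pair-injective i j i′ j′ eq))
body-injective (neg φ) (neg ψ) _ eq = cong neg (code-injective φ ψ eq)
body-injective (conj φ φ′) (conj ψ ψ′) _ eq =
  cong₂ conj (code-injective φ ψ (proj₁ (pair-injective (code φ) (code φ′) (code ψ) (code ψ′) eq)))
             (code-injective φ′ ψ′ (proj₂ (pair-injective (code φ) (code φ′) (code ψ) (code ψ′) eq)))
body-injective (ex φ) (ex ψ) _ eq = cong ex (code-injective φ ψ eq)

-- The local function of eval for prec takes the recursion argument x as an extra
-- parameter; it has no name outside eval, so it is recovered by unification.
mutual
  iterate : ∀ {k} → PR k → PR (suc (suc k)) → Vec ℕ k → ℕ → ℕ → ℕ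
  iterate = _

  eval-prec-iterate : ∀ {k} (f : PR k) g xs n →
    eval (prec f g) (suc n ∷ xs) ≡ eval g (n ∷ iterate f g xs (suc n) n ∷ xs)
  eval-prec-iterate f g xs n with suc n
  ... | x = refl

-- Evaluation at `suc n` and at `n` runs two instances of the local recursion with different
-- captured arguments; identifying them gives the usual recursion equation.
iterate-const : ∀ {k} (f : PR k) g xs x y n → iterate f g xs x n ≡ iterate f g xs y n
iterate-const f g xs x y zero    = refl
iterate-const f g xs x y (suc n) = cong (λ r → eval g (n ∷ r ∷ xs)) (iterate-const f g xs x y n)

eval-prec-suc : ∀ {k} (f : PR k) g xs n →
  eval (prec f g) (suc n ∷ xs) ≡ eval g (n ∷ eval (prec f g) (n ∷ xs) ∷ xs)
eval-prec-suc f g xs n = cong (λ r → eval g (n ∷ r ∷ xs)) (iterate-const f g xs (suc n) n n)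

constPR : ∀ {k} → ℕ → PR k
constPR zero    = zer
constPR (suc n) = comp succ (constPR n ∷ [])

eval-constPR : ∀ {k} n (xs : Vec ℕ k) → eval (constPR n) xs ≡ n
eval-constPR zero    xs = refl
eval-constPR (suc n) xs = cong suc (eval-constPR n xs)

plusPR : PR 2
plusPR = prec (proj zero) (comp succ (proj (suc zero) ∷ []))

eval-plusPR : ∀ m n → eval plusPR (m ∷ n ∷ []) ≡ m + n
eval-plusPR zero    n = refl
eval-plusPR (suc m) n = trans
  (eval-prec-suc (proj zero) (comp succ (proj (suc zero) ∷ [])) (n ∷ []) m)
  (cong suc (eval-plusPR m n))

triStepPR : PR 2
triStepPR = comp plusPR (comp succ (proj zero ∷ []) ∷ proj (suc zero) ∷ [])

triPR : PR 1
triPR = prec zer triStepPR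

eval-triPR : ∀ n → eval triPR (n ∷ []) ≡ tri n
eval-triPR zero    = refl
eval-triPR (suc n) = begin
  eval triPR (suc n ∷ [])                        ≡⟨ eval-prec-suc zer triStepPR [] n ⟩
  eval plusPR (suc n ∷ eval triPR (n ∷ []) ∷ []) ≡⟨ eval-plusPR (suc n) (eval triPR (n ∷ [])) ⟩
  suc n + eval triPR (n ∷ [])                    ≡⟨ cong (suc n +_) (eval-triPR n) ⟩
  suc n + tri n                                  ∎
  where open ≡-Reasoning

pairPR : ∀ {k} → PR k → PR k → PR k
pairPR f g = comp plusPR (comp triPR (comp plusPR (f ∷ g ∷ []) ∷ []) ∷ g ∷ [])

eval-pairPR : ∀ {k} (f g : PR k) xs →
  eval (pairPR f g) xs ≡ pair (eval f xs) (eval g xs)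
eval-pairPR f g xs = begin
  eval (pairPR f g) xs                ≡⟨ eval-plusPR (eval triPR (s ∷ [])) b ⟩
  eval triPR (s ∷ []) + b             ≡⟨ cong (_+ b) (eval-triPR s) ⟩
  tri s + b                           ≡⟨ cong (λ s → tri s + b) (eval-plusPR a b) ⟩
  pair a b                            ∎
  where
  open ≡-Reasoning
  a b s : ℕ
  a = eval f xs
  b = eval g xs
  s = eval plusPR (a ∷ b ∷ [])

tagPR : ∀ {k} → ℕ → PR k → PR k
tagPR t = pairPR (constPR t)

eval-tagPR : ∀ {k} t (f : PR k) xs → eval (tagPR t f) xs ≡ pair t (eval f xs)
eval-tagPR t f xs = trans (eval-pairPR (constPR t) f xs) (cong (λ t → pair t (eval f xs)) (eval-constPR t xs))

negPR exPR : ∀ {k} → PR k → PR k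
negPR = tagPR 2
exPR  = tagPR 4

conjPR : ∀ {k} → PR k → PR k → PR k
conjPR f g = tagPR 3 (pairPR f g)

-- A record rather than an abbreviation, so that formulas are inferred
-- without ever unfolding the (astronomically large) codes.
record Computes {k} (f : PR k) (xs : Vec ℕ k) (φ : Fm) : Set where
  constructor computes
  field eval≡code : eval f xs ≡ code φ
open Computes

module _ {k} {xs : Vec ℕ k} where

  const-computes : ∀ φ → Computes (constPR (code φ)) xs φ
  const-computes φ = computes (eval-constPR (code φ) xs)

  neg-computes : ∀ {f φ} → Computes f xs φ → Computes (negPR f) xs (neg φ)
  neg-computes {f} {φ} (computes p) = computes (trans (eval-tagPR 2 f xs) (cong (pair 2) p))

  ex-computes : ∀ {f φ} → Computes f xs φ → Computes (exPR f) xs (ex φ)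
  ex-computes {f} {φ} (computes p) = computes (trans (eval-tagPR 4 f xs) (cong (pair 4) p))

  conj-computes : ∀ {f g φ ψ} → Computes f xs φ → Computes g xs ψ → Computes (conjPR f g) xs (conj φ ψ)
  conj-computes {f} {g} {φ} {ψ} (computes p) (computes q) = computes
    (trans (eval-tagPR 3 (pairPR f g) xs)
      (cong (pair 3) (trans (eval-pairPR f g xs) (cong₂ pair p q))))

module Diagonal (edgeless matching isZero isSucc : Fm) where

  -- The predecessor is bound as index 0, so `numeralFm n` recurs verbatim in its successor and the
  -- codes follow a plain primitive recursion, without renaming of variables.
  numeralFm : ℕ → Fm
  numeralFm zero    = isZero
  numeralFm (suc n) = ex (conj isSucc (numeralFm n))

  numeralStepPR : PR 2
  numeralStepPR = exPR (conjPR (constPR (code isSucc)) (proj (suc zero)))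

  numeralPR : PR 1
  numeralPR = prec (constPR (code isZero)) numeralStepPR

  numeral-computes : ∀ n → Computes numeralPR (n ∷ []) (numeralFm n)
  numeral-computes zero    = computes (eval≡code (const-computes {xs = []} isZero))
  numeral-computes (suc n) = computes
    (trans (eval-prec-suc (constPR (code isZero)) numeralStepPR [] n)
      (eval≡code (ex-computes (conj-computes (const-computes isSucc)
        (computes {f = proj (suc zero)} {xs = n ∷ eval numeralPR (n ∷ []) ∷ []} {φ = numeralFm n}
          (eval≡code (numeral-computes n)))))))

  -- This is `edgeless ∨ (matching ∧ ∃ u (u is e ∧ κ u))`. The number enters through a quantifier,
  -- so that no syntactic substitution has to be arithmetised.
  instanceFm : Fm → ℕ → Fm
  instanceFm κ e = neg (conj (neg edgeless) (neg (conj matching (ex (conj (numeralFm e) κ)))))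

  -- The input, a code of `κ`, is used twice: as the number described by `numeralPR` and, through
  -- `proj zero`, as the code of the formula applied to it.
  diagonalPR : PR 1
  diagonalPR = negPR (conjPR (negPR (constPR (code edgeless)))
    (negPR (conjPR (constPR (code matching)) (exPR (conjPR numeralPR (proj zero))))))

  diagonal-computes : ∀ κ {θ} → θ ≡ instanceFm κ (code κ) → Computes diagonalPR (code κ ∷ []) θ
  diagonal-computes κ refl =
    neg-computes (conj-computes (neg-computes (const-computes edgeless))
      (neg-computes (conj-computes (const-computes matching)
        (ex-computes (conj-computes (numeral-computes (code κ)) (computes refl))))))

-- Graphs and counting

edge-irrefl : ∀ {n} (g : Graph n) i → edge g i i ≡ false
edge-irrefl {suc n} (g , v) zero    = refl
edge-irrefl {suc n} (g , v) (suc i) = edge-irrefl g i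

edge-sym : ∀ {n} (g : Graph n) i j → edge g i j ≡ edge g j i
edge-sym {suc n} (g , v) zero    zero    = refl
edge-sym {suc n} (g , v) zero    (suc j) = refl
edge-sym {suc n} (g , v) (suc i) zero    = refl
edge-sym {suc n} (g , v) (suc i) (suc j) = edge-sym g i j

graph : ∀ {n} → (Fin n → Fin n → Bool) → Graph n
graph {zero}  f = tt
graph {suc n} f = graph (λ i j → f (suc i) (suc j)) , tabulate (λ j → f zero (suc j))

edge-graph : ∀ {n} {f : Fin n → Fin n → Bool} → (∀ i → f i i ≡ false) → (∀ i j → f i j ≡ f j i) →
  ∀ i j → edge (graph f) i j ≡ f i j
edge-graph {suc n} {f} irr sy zero    zero    = sym (irr zero)
edge-graph {suc n} {f} irr sy zero    (suc j) = Vec.lookup∘tabulate (λ j → f zero (suc j)) j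
edge-graph {suc n} {f} irr sy (suc i) zero    =
  trans (Vec.lookup∘tabulate (λ j → f zero (suc j)) i) (sy zero (suc i))
edge-graph {suc n} {f} irr sy (suc i) (suc j) =
  edge-graph (λ i → irr (suc i)) (λ i j → sy (suc i) (suc j)) i j

Edgeless : ∀ {n} → Graph n → Set
Edgeless g = ∀ i j → ¬ (edge g i j ≡ true)

emptyGraph : ∀ n → Graph n
emptyGraph n = graph (λ _ _ → false)

emptyGraph-edgeless : ∀ n → Edgeless (emptyGraph n)
emptyGraph-edgeless n i j eq with trans (sym eq) (edge-graph (λ _ → refl) (λ _ _ → refl) i j)
... | ()

edge-ext : ∀ {n} (g h : Graph n) → (∀ i j → edge g i j ≡ edge h i j) → g ≡ h
edge-ext {zero}  tt tt eq = refl
edge-ext {suc n} (g , v) (h , w) eq = cong₂ _,_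
  (edge-ext g h (λ i j → eq (suc i) (suc j)))
  (trans (sym (Vec.tabulate∘lookup v)) (trans (Vec.tabulate-cong (λ j → eq zero (suc j))) (Vec.tabulate∘lookup w)))

edgeless-unique : ∀ {n} (g h : Graph n) → Edgeless g → Edgeless h → g ≡ h
edgeless-unique g h ¬g ¬h = edge-ext g h λ i j → trans (isFalse (¬g i j)) (sym (isFalse (¬h i j)))
  where
  isFalse : ∀ {b} → ¬ (b ≡ true) → b ≡ false
  isFalse {true}  ¬b = ⊥-elim (¬b refl)
  isFalse {false} ¬b = refl

∈-allVecs : ∀ {m} (v : Vec Bool m) → v ∈ allVecs m
∈-allVecs []          = here refl
∈-allVecs (true ∷ v)  = ∈-concatMap⁺ _ (lose (∈-allVecs v) (here refl))
∈-allVecs (false ∷ v) = ∈-concatMap⁺ _ (lose (∈-allVecs v) (there (here refl)))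

∈-allGraphs : ∀ {n} (g : Graph n) → g ∈ allGraphs n
∈-allGraphs {zero}  tt      = here refl
∈-allGraphs {suc n} (g , v) = ∈-concatMap⁺ _ (lose (∈-allGraphs g) (∈-map⁺ (g ,_) (∈-allVecs v)))

-- `key` recovers from an element the block that it came from, so blocks of distinct origin are
-- disjoint.
concatMap-unique : ∀ {A B : Set} (f : A → List B) (key : B → A) →
  (∀ x {y} → y ∈ f x → key y ≡ x) → (∀ x → Unique (f x)) →
  ∀ {xs} → Unique xs → Unique (concatMap f xs)
concatMap-unique f key key-f f! xs! = Unique.concat⁺
  (All.map⁺ (All.universal f! _))
  (AllPairs.map⁺ (AllPairs.map (λ x≢x′ {_} (y∈ , y∈′) → x≢x′ (trans (sym (key-f _ y∈)) (key-f _ y∈′))) xs!))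

allVecs-unique : ∀ m → Unique (allVecs m)
allVecs-unique zero    = [] ∷ []
allVecs-unique (suc m) = concatMap-unique _ Vec.tail
  (λ { v (here refl) → refl ; v (there (here refl)) → refl ; v (there (there ())) })
  (λ v → ((λ ()) ∷ []) ∷ [] ∷ []) (allVecs-unique m)

allGraphs-unique : ∀ n → Unique (allGraphs n)
allGraphs-unique zero    = [] ∷ []
allGraphs-unique (suc n) = concatMap-unique _ proj₁
  (λ g y∈ → case ∈-map⁻ (g ,_) y∈ of λ { (_ , _ , refl) → refl })
  (λ g → Unique.map⁺ (λ { refl → refl }) (allVecs-unique n)) (allGraphs-unique n)

T⇔ : ∀ {A : Set} {b} → Reflects A b → T b ⇔ A
T⇔ (ofʸ a)  = mk⇔ (λ _ → a) (λ _ → tt)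
T⇔ (ofⁿ ¬a) = mk⇔ (λ ()) ¬a

_⊨T_ : ∀ {n} → Graph n → Fm → Set
g ⊨T φ = T (g ⊨ φ)

⊨-conj : ∀ {n} (g : Graph n) φ ψ → g ⊨T conj φ ψ ⇔ (g ⊨T φ × g ⊨T ψ)
⊨-conj g φ ψ = T-∧ {g ⊨ φ} {g ⊨ ψ}

⊨-neg : ∀ {n} (g : Graph n) φ → g ⊨T neg φ ⇔ (¬ (g ⊨T φ))
⊨-neg g φ = T⇔ (¬-reflects (T-reflects (g ⊨ φ)))

module _ {n : ℕ} (φ : Fm) where

  count-some : (g : Graph n) → g ⊨T φ → 0 < count n φ
  count-some g p = filter-some (λ g → T? (g ⊨ φ)) (lose (∈-allGraphs g) p)

  count-none : (∀ (g : Graph n) → ¬ (g ⊨T φ)) → count n φ ≡ 0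
  count-none none = cong length (filter-none (λ g → T? (g ⊨ φ)) (All.universal none (allGraphs n)))

  count-atMostOne : (∀ (g h : Graph n) → g ⊨T φ → h ⊨T φ → g ≡ h) → count n φ ≤ 1
  count-atMostOne same = length≤1 _ (Unique.filter⁺ P? (allGraphs-unique n))
    (λ g∈ h∈ → same _ _ (proj₂ (∈-filter⁻ P? {xs = allGraphs n} g∈))
                        (proj₂ (∈-filter⁻ P? {xs = allGraphs n} h∈)))
    where
    P? = λ (g : Graph n) → T? (g ⊨ φ)
    length≤1 : ∀ (gs : List (Graph n)) → Unique gs → (∀ {g h} → g ∈ gs → h ∈ gs → g ≡ h) → length gs ≤ 1
    length≤1 []           _                 _  = z≤n
    length≤1 (g ∷ [])     _                 _  = s≤s z≤n
    length≤1 (g ∷ h ∷ gs) ((g≢h ∷ _) ∷ _) eq = ⊥-elim (g≢h (eq (here refl) (there (here refl))))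

length-filter-split : ∀ {A : Set} (p q : A → Bool) xs →
  length (filterᵇ p xs) ≡
  length (filterᵇ (λ x → p x ∧ q x) xs) + length (filterᵇ (λ x → p x ∧ not (q x)) xs)
length-filter-split p q [] = refl
length-filter-split p q (x ∷ xs) with p x | q x
... | false | _     = length-filter-split p q xs
... | true  | true  = cong suc (length-filter-split p q xs)
... | true  | false = trans (cong suc (length-filter-split p q xs)) (sym (+-suc _ _))

count-split : ∀ n φ ψ → count n φ ≡ count n (conj φ ψ) + count n (conj φ (neg ψ))
count-split n φ ψ = length-filter-split (_⊨ φ) (_⊨ ψ) (allGraphs n)

any⇔ : ∀ {n} (p : Fin n → Bool) → T (any p (List.allFin n)) ⇔ ∃ λ a → T (p a)
any⇔ {n} p = mk⇔
  (λ t → let a , _ , pa = find (any⁻ p (List.allFin n) t) in a , pa)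
  (λ (a , pa) → any⁺ p (lose (∈-allFin a) pa))

-- The first-order theory of edgeless graphs

depth : Fm → ℕ
depth (eqv i j)  = 0
depth (adj i j)  = 0
depth (neg φ)    = depth φ
depth (conj φ ψ) = depth φ ⊔ depth ψ
depth (ex φ)     = suc (depth φ)

-- If every vertex occurred in `xs`, two of them would share a position by the pigeonhole principle.
fresh : ∀ {n} (xs : List (Fin n)) → length xs < n → ∃ λ a → ¬ (a ∈ xs)
fresh {n} xs lt = Fin.¬∀⟶∃¬ n (_∈ xs) (_∈? xs) λ all →
  let i , j , i<j , eq = Fin.pigeonhole lt (λ a → index (all a)) in
  Fin.<⇒≢ i<j (trans (lookup-index (all i)) (trans (cong (List.lookup xs) eq) (sym (lookup-index (all j)))))
  where open DecMembership Fin._≟_ using (_∈?_)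

∈⇒nth : ∀ {A : Set} {a : A} {xs} → a ∈ xs → ∃ λ i → nth xs i ≡ just a
∈⇒nth (here refl) = 0 , refl
∈⇒nth (there a∈)  = let i , eq = ∈⇒nth a∈ in suc i , eq

nth⇒∈ : ∀ {A : Set} {a : A} xs i → nth xs i ≡ just a → a ∈ xs
nth⇒∈ (x ∷ xs) zero    refl = here refl
nth⇒∈ (x ∷ xs) (suc i) eq   = there (nth⇒∈ xs i eq)

-- `atomEq` is false on unassigned variables, so the cases with `i` equal to `j` also record which
-- variables are assigned.
SameType : ∀ {m n} → List (Fin m) → List (Fin n) → Set
SameType ρ σ = ∀ i j → atomEq (nth ρ i) (nth ρ j) ≡ atomEq (nth σ i) (nth σ j)

atomEq-refl : ∀ {n} (a : Fin n) → atomEq (just a) (just a) ≡ true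
atomEq-refl a = trans (isYes≗does (a Fin.≟ a)) (dec-true (a Fin.≟ a) refl)

atomEq-sym : ∀ {n} (x y : Maybe (Fin n)) → atomEq x y ≡ atomEq y x
atomEq-sym nothing  nothing  = refl
atomEq-sym nothing  (just b) = refl
atomEq-sym (just a) nothing  = refl
atomEq-sym (just a) (just b) with a Fin.≟ b
... | yes refl = sym (atomEq-refl a)
... | no a≢b   = sym (trans (isYes≗does (b Fin.≟ a)) (dec-false (b Fin.≟ a) (a≢b ∘ sym)))

atomEq-fresh : ∀ {n} (a : Fin n) ρ → ¬ (a ∈ ρ) → ∀ j → atomEq (just a) (nth ρ j) ≡ false
atomEq-fresh a ρ a∉ρ j with nth ρ j in eq
... | nothing = refl
... | just b  = trans (isYes≗does (a Fin.≟ b)) (dec-false (a Fin.≟ b) λ { refl → a∉ρ (nth⇒∈ ρ j eq) })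

defined : ∀ {n} (x : Maybe (Fin n)) → atomEq x x ≡ true → ∃ λ a → x ≡ just a
defined (just a) _ = a , refl

sameType-∷ : ∀ {m n} {ρ : List (Fin m)} {σ : List (Fin n)} {a b} → SameType ρ σ →
  (∀ j → atomEq (just a) (nth ρ j) ≡ atomEq (just b) (nth σ j)) → SameType (a ∷ ρ) (b ∷ σ)
sameType-∷ {a = a} {b} st eq zero    zero    = trans (atomEq-refl a) (sym (atomEq-refl b))
sameType-∷             st eq zero    (suc j) = eq j
sameType-∷ {ρ = ρ} {σ} {a} {b} st eq (suc i) zero =
  trans (atomEq-sym (nth ρ i) (just a)) (trans (eq i) (atomEq-sym (just b) (nth σ i)))
sameType-∷             st eq (suc i) (suc j) = st i j

-- Duplicator's answer: a vertex chosen before is answered by the one at the same position, a new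
-- vertex by a new one.
sameType-extend : ∀ {m n} {ρ : List (Fin m)} {σ : List (Fin n)} → SameType ρ σ → length σ < n →
  ∀ a → ∃ λ b → SameType (a ∷ ρ) (b ∷ σ)
sameType-extend {ρ = ρ} {σ} st lt a with DecMembership._∈?_ Fin._≟_ a ρ
... | no a∉ρ = let b , b∉σ = fresh σ lt in
  b , sameType-∷ {ρ = ρ} {σ} st (λ j → trans (atomEq-fresh a ρ a∉ρ j) (sym (atomEq-fresh b σ b∉σ j)))
... | yes a∈ρ =
  let i , ρi≡a = ∈⇒nth a∈ρ
      b , σi≡b = defined (nth σ i) (trans (sym (st i i)) (trans (cong (λ x → atomEq x x) ρi≡a) (atomEq-refl a)))
  in b , sameType-∷ {ρ = ρ} {σ} st (λ j → trans (cong (λ x → atomEq x (nth ρ j)) (sym ρi≡a))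
                 (trans (st i j) (cong (λ x → atomEq x (nth σ j)) σi≡b)))

atomAdj-edgeless : ∀ {n} {g : Graph n} → Edgeless g → ∀ x y → atomAdj g x y ≡ false
atomAdj-edgeless el nothing  y        = refl
atomAdj-edgeless el (just a) nothing  = refl
atomAdj-edgeless {g = g} el (just a) (just b) with edge g a b in eq
... | true  = ⊥-elim (el a b eq)
... | false = refl

T-ext : ∀ {b c} → (T b → T c) → (T c → T b) → b ≡ c
T-ext {true}  {true}  _ _ = refl
T-ext {true}  {false} f _ = ⊥-elim (f tt)
T-ext {false} {true}  _ g = ⊥-elim (g tt)
T-ext {false} {false} _ _ = refl

-- Duplicator wins the Ehrenfeucht–Fraïssé game on two edgeless graphs with enough vertices.
sat-edgeless : ∀ φ {m n} {g : Graph m} {h : Graph n} → Edgeless g → Edgeless h → ∀ ρ σ → SameType ρ σ →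
  length ρ + depth φ ≤ m → length σ + depth φ ≤ n → sat g ρ φ ≡ sat h σ φ
sat-edgeless (eqv i j) eg eh ρ σ st ρ≤ σ≤ = st i j
sat-edgeless (adj i j) eg eh ρ σ st ρ≤ σ≤ =
  trans (atomAdj-edgeless eg (nth ρ i) (nth ρ j)) (sym (atomAdj-edgeless eh (nth σ i) (nth σ j)))
sat-edgeless (neg φ) eg eh ρ σ st ρ≤ σ≤ = cong not (sat-edgeless φ eg eh ρ σ st ρ≤ σ≤)
sat-edgeless (conj φ ψ) eg eh ρ σ st ρ≤ σ≤ = cong₂ _∧_
  (sat-edgeless φ eg eh ρ σ st (weakenˡ ρ≤) (weakenˡ σ≤))
  (sat-edgeless ψ eg eh ρ σ st (weakenʳ ρ≤) (weakenʳ σ≤))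
  where
  weakenˡ : ∀ {k l} → k + (depth φ ⊔ depth ψ) ≤ l → k + depth φ ≤ l
  weakenˡ {k} = ≤-trans (+-monoʳ-≤ k (m≤m⊔n (depth φ) (depth ψ)))
  weakenʳ : ∀ {k l} → k + (depth φ ⊔ depth ψ) ≤ l → k + depth ψ ≤ l
  weakenʳ {k} = ≤-trans (+-monoʳ-≤ k (m≤n⊔m (depth φ) (depth ψ)))
sat-edgeless (ex φ) {m} {n} {g} {h} eg eh ρ σ st ρ≤ σ≤ = T-ext
  (transfer (λ a → let b , st′ = sameType-extend {ρ = ρ} {σ} st (room σ≤) a in
                   b , sat-edgeless φ eg eh (a ∷ ρ) (b ∷ σ) st′ (next ρ≤) (next σ≤)))
  (transfer (λ b → let a , st′ = sameType-extend {ρ = σ} {ρ} (λ i j → sym (st i j)) (room ρ≤) b in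
                   a , sat-edgeless φ eh eg (b ∷ σ) (a ∷ ρ) st′ (next σ≤) (next ρ≤)))
  where
  room : ∀ {k l} → k + suc (depth φ) ≤ l → k < l
  room {k} = ≤-trans (≤-trans (s≤s (m≤m+n k (depth φ))) (≤-reflexive (sym (+-suc k (depth φ)))))
  next : ∀ {k l} → k + suc (depth φ) ≤ l → suc k + depth φ ≤ l
  next {k} = ≤-trans (≤-reflexive (sym (+-suc k (depth φ))))
  transfer : ∀ {k l} {p : Fin k → Bool} {q : Fin l → Bool} → (∀ a → ∃ λ b → p a ≡ q b) →
    T (any p (List.allFin k)) → T (any q (List.allFin l))
  transfer {p = p} {q} f t =
    let a , pa = to (any⇔ p) t
        b , eq = f a
    in from (any⇔ q) (b , subst T eq pa)

-- From order `depth ψ` on, all models agree on `ψ` with the empty graph of that order, so either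
-- `ψ` or its negation has count 0 there.
edgeless-zeroOneLaw : ∀ φ → (∀ {n} (g : Graph n) → g ⊨T φ ⇔ Edgeless g) → ZeroOneLaw φ
edgeless-zeroOneLaw φ models =
  (0 , λ n _ → count-some φ (emptyGraph n) (from (models _) (emptyGraph-edgeless n))) , law
  where
  constant : ∀ ψ {n} (g : Graph n) → g ⊨T φ → depth ψ ≤ n → g ⊨ ψ ≡ emptyGraph (depth ψ) ⊨ ψ
  constant ψ g g⊨φ le = sat-edgeless ψ (to (models g) g⊨φ) (emptyGraph-edgeless (depth ψ))
    [] [] (λ _ _ → refl) le ≤-refl

  vanishes : ∀ ψ → emptyGraph (depth ψ) ⊨ ψ ≡ false → TendsToZero φ ψ
  vanishes ψ eq k _ = depth ψ , λ n le →
    ≤-trans (≤-reflexive (trans (cong (k *_) (count-none {n} (conj φ ψ) (λ g g⊨ →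
      let g⊨φ , g⊨ψ = to (⊨-conj g φ ψ) g⊨ in
      subst T (trans (constant ψ g g⊨φ le) eq) g⊨ψ))) (*-zeroʳ k))) z≤n

  law : ∀ ψ → Sentence ψ → TendsToZero φ ψ ⊎ TendsToOne φ ψ
  law ψ _ with emptyGraph (depth ψ) ⊨ ψ in eq
  ... | false = inj₁ (vanishes ψ eq)
  ... | true  = inj₂ (vanishes (neg ψ) (cong not eq))

-- Scoped formulas

data Formula (k : ℕ) : Set where
  _≐_ _∼_             : Fin k → Fin k → Formula k
  ¬ᶠ_                 : Formula k → Formula k
  _∧ᶠ_ _∨ᶠ_ _⇒ᶠ_      : Formula k → Formula k → Formula k
  ∃ᶠ_ ∀ᶠ_             : Formula (suc k) → Formula k

infix  8 _≐_ _∼_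
infix  7 ¬ᶠ_
infixr 6 _∧ᶠ_
infixr 5 _∨ᶠ_
infixr 4 _⇒ᶠ_
infix  3 ∃ᶠ_ ∀ᶠ_

erase : ∀ {k} → Formula k → Fm
erase (i ≐ j)  = eqv (toℕ i) (toℕ j)
erase (i ∼ j)  = adj (toℕ i) (toℕ j)
erase (¬ᶠ φ)   = neg (erase φ)
erase (φ ∧ᶠ ψ) = conj (erase φ) (erase ψ)
erase (φ ∨ᶠ ψ) = neg (conj (neg (erase φ)) (neg (erase ψ)))
erase (φ ⇒ᶠ ψ) = neg (conj (erase φ) (neg (erase ψ)))
erase (∃ᶠ φ)   = ex (erase φ)
erase (∀ᶠ φ)   = neg (ex (neg (erase φ)))

erase-wellScoped : ∀ {k} (φ : Formula k) → WellScoped k (erase φ)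
erase-wellScoped (i ≐ j)  = Fin.toℕ<n i , Fin.toℕ<n j
erase-wellScoped (i ∼ j)  = Fin.toℕ<n i , Fin.toℕ<n j
erase-wellScoped (¬ᶠ φ)   = erase-wellScoped φ
erase-wellScoped (φ ∧ᶠ ψ) = erase-wellScoped φ , erase-wellScoped ψ
erase-wellScoped (φ ∨ᶠ ψ) = erase-wellScoped φ , erase-wellScoped ψ
erase-wellScoped (φ ⇒ᶠ ψ) = erase-wellScoped φ , erase-wellScoped ψ
erase-wellScoped (∃ᶠ φ)   = erase-wellScoped φ
erase-wellScoped (∀ᶠ φ)   = erase-wellScoped φ

Holds : ∀ {n k} → Graph n → Vec (Fin n) k → Formula k → Set
Holds g ρ (i ≐ j)  = lookup ρ i ≡ lookup ρ j
Holds g ρ (i ∼ j)  = edge g (lookup ρ i) (lookup ρ j) ≡ true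
Holds g ρ (¬ᶠ φ)   = ¬ Holds g ρ φ
Holds g ρ (φ ∧ᶠ ψ) = Holds g ρ φ × Holds g ρ ψ
Holds g ρ (φ ∨ᶠ ψ) = Holds g ρ φ ⊎ Holds g ρ ψ
Holds g ρ (φ ⇒ᶠ ψ) = Holds g ρ φ → Holds g ρ ψ
Holds g ρ (∃ᶠ φ)   = ∃ λ a → Holds g (a ∷ ρ) φ
Holds g ρ (∀ᶠ φ)   = ∀ a → Holds g (a ∷ ρ) φ

nth-toList : ∀ {A : Set} {k} (ρ : Vec A k) i → nth (toList ρ) (toℕ i) ≡ just (lookup ρ i)
nth-toList (x ∷ ρ) zero    = refl
nth-toList (x ∷ ρ) (suc i) = nth-toList ρ i

≡true-reflects : ∀ b → Reflects (b ≡ true) b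
≡true-reflects true  = ofʸ refl
≡true-reflects false = ofⁿ λ ()

∨-reflects : ∀ {A B : Set} {a b} → Reflects A a → Reflects B b → Reflects (A ⊎ B) (not (not a ∧ not b))
∨-reflects (ofʸ a)  _        = ofʸ (inj₁ a)
∨-reflects (ofⁿ ¬a) (ofʸ b)  = ofʸ (inj₂ b)
∨-reflects (ofⁿ ¬a) (ofⁿ ¬b) = ofⁿ λ { (inj₁ a) → ¬a a ; (inj₂ b) → ¬b b }

⇒-reflects : ∀ {A B : Set} {a b} → Reflects A a → Reflects B b → Reflects (A → B) (not (a ∧ not b))
⇒-reflects (ofʸ a)  (ofʸ b)  = ofʸ λ _ → b
⇒-reflects (ofʸ a)  (ofⁿ ¬b) = ofⁿ λ f → ¬b (f a)
⇒-reflects (ofⁿ ¬a) _        = ofʸ λ a → ⊥-elim (¬a a)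

∃-reflects : ∀ {n} {P : Fin n → Set} {p : Fin n → Bool} → (∀ a → Reflects (P a) (p a)) →
  Reflects (∃ P) (any p (List.allFin n))
∃-reflects {p = p} r = fromEquivalence
  (λ t → let a , pa = to (any⇔ p) t in a , to (T⇔ (r a)) pa)
  (λ (a , Pa) → from (any⇔ p) (a , from (T⇔ (r a)) Pa))

∀-reflects : ∀ {n} {P : Fin n → Set} {p : Fin n → Bool} → (∀ a → Reflects (P a) (p a)) →
  Reflects (∀ a → P a) (not (any (λ a → not (p a)) (List.allFin n)))
∀-reflects {n} {p = p} r with any (λ a → not (p a)) (List.allFin n) | ∃-reflects (λ a → ¬-reflects (r a))
... | true  | ofʸ (a , ¬Pa) = ofⁿ λ all → ¬Pa (all a)
... | false | ofⁿ ¬∃        = ofʸ λ a → stable (r a) λ ¬Pa → ¬∃ (a , ¬Pa)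
  where
  stable : ∀ {A : Set} {b} → Reflects A b → ¬ ¬ A → A
  stable (ofʸ a)  _   = a
  stable (ofⁿ ¬a) ¬¬a = ⊥-elim (¬¬a ¬a)

-- Over a finite graph all connectives and quantifiers are decidable, so the constructive reading
-- agrees with the Boolean one, even for the classically encoded disjunction and universal
-- quantifier.
Holds-reflects : ∀ {n k} (g : Graph n) (ρ : Vec (Fin n) k) φ → Reflects (Holds g ρ φ) (sat g (toList ρ) (erase φ))
Holds-reflects g ρ (i ≐ j) rewrite nth-toList ρ i | nth-toList ρ j | isYes≗does (lookup ρ i Fin.≟ lookup ρ j) =
  proof (lookup ρ i Fin.≟ lookup ρ j)
Holds-reflects g ρ (i ∼ j) rewrite nth-toList ρ i | nth-toList ρ j =
  ≡true-reflects (edge g (lookup ρ i) (lookup ρ j))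
Holds-reflects g ρ (¬ᶠ φ)   = ¬-reflects (Holds-reflects g ρ φ)
Holds-reflects g ρ (φ ∧ᶠ ψ) = Holds-reflects g ρ φ ×-reflects Holds-reflects g ρ ψ
Holds-reflects g ρ (φ ∨ᶠ ψ) = ∨-reflects (Holds-reflects g ρ φ) (Holds-reflects g ρ ψ)
Holds-reflects g ρ (φ ⇒ᶠ ψ) = ⇒-reflects (Holds-reflects g ρ φ) (Holds-reflects g ρ ψ)
Holds-reflects g ρ (∃ᶠ φ)   = ∃-reflects (λ a → Holds-reflects g (a ∷ ρ) φ)
Holds-reflects g ρ (∀ᶠ φ)   = ∀-reflects (λ a → Holds-reflects g (a ∷ ρ) φ)

Holds? : ∀ {n k} (g : Graph n) (ρ : Vec (Fin n) k) φ → Dec (Holds g ρ φ)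
Holds? g ρ φ = sat g (toList ρ) (erase φ) because Holds-reflects g ρ φ

⊨⇔Holds : ∀ {n} (g : Graph n) (φ : Formula 0) → g ⊨T erase φ ⇔ Holds g [] φ
⊨⇔Holds g φ = T⇔ (Holds-reflects g [] φ)

-- Numbers and computations inside a graph

module _ {k : ℕ} where

  -- Leaves only serve the parity constraint; arithmetic ignores them by using core adjacency.
  leaf : Fin k → Formula k
  leaf i = ∀ᶠ ∀ᶠ suc (suc i) ∼ 1F ⇒ᶠ suc (suc i) ∼ 0F ⇒ᶠ 1F ≐ 0F

  core : Fin k → Fin k → Formula k
  core i j = i ∼ j ∧ᶠ ¬ᶠ leaf i ∧ᶠ ¬ᶠ leaf j

  matched : Fin k → Fin k → Formula k
  matched i j = i ∼ j ∧ᶠ (leaf i ∨ᶠ leaf j)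

-- Vertices are compared by inclusion of core neighbourhoods, hence numbers are determined only up
-- to equal core neighbourhoods. A predecessor is a greatest element among the vertices strictly
-- below.
sub below isSucc : ∀ {k} → Fin k → Fin k → Formula k
sub i j    = ∀ᶠ core 0F (suc i) ⇒ᶠ core 0F (suc j)
below i j  = sub i j ∧ᶠ ¬ᶠ sub j i
isSucc i j = below i j ∧ᶠ (∀ᶠ below 0F (suc j) ⇒ᶠ sub 0F (suc i))

-- Zero means having no predecessor rather than having an empty neighbourhood; this makes every
-- vertex of every graph denote some number.
isZero : ∀ {k} → Fin k → Formula k
isZero j = ¬ᶠ (∃ᶠ isSucc 0F (suc j))

numeral : ∀ {k} → ℕ → Formula (suc k)
numeral zero    = isZero 0F
numeral (suc n) = ∃ᶠ isSucc 0F 1F ∧ᶠ numeral n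

-- (p , q) codes the relation i ↦ v: a path p – r – s – q where r and s are tagged with i and v by
-- being their successors.
trace : ∀ {k} → Fin k → Fin k → Fin k → Fin k → Formula k
trace p q i v = ∃ᶠ ∃ᶠ core (2 ↑ʳ p) 1F ∧ᶠ core 1F 0F ∧ᶠ core 0F (2 ↑ʳ q) ∧ᶠ
                      isSucc (2 ↑ʳ i) 1F ∧ᶠ isSucc (2 ↑ʳ v) 0F

∃* : ∀ {k} m → Formula (m + k) → Formula k
∃* zero    φ = φ
∃* (suc m) φ = ∃* m (∃ᶠ φ)

bound : ∀ m c → Vec (Fin (m + c)) m
bound m c = map (_↑ˡ c) (allFin m)

-- Values count up to equal core neighbourhoods, which is why `proj` asks for mutual inclusion
-- instead of equality.
evaluates    : ∀ {k c} → PR k → Vec (Fin c) k → Fin c → Formula c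
evaluatesAll : ∀ {k c m} → Vec (PR k) m → Vec (Fin c) k → Vec (Fin c) m → Formula c

evaluates zer        xs       y = isZero y
evaluates succ       (x ∷ []) y = isSucc x y
evaluates (proj i)   xs       y = sub (lookup xs i) y ∧ᶠ sub y (lookup xs i)
evaluates {c = c} (comp {m} f gs) xs y =
  ∃* m (evaluatesAll gs (map (m ↑ʳ_) xs) (bound m c) ∧ᶠ evaluates f (bound m c) (m ↑ʳ y))
evaluates (prec f g) (x ∷ xs) y =
  ∃ᶠ ∃ᶠ trace 1F 0F (2 ↑ʳ x) (2 ↑ʳ y) ∧ᶠ
    -- Only entries with index at most `x` are checked: in the intended models, values at larger
    -- indices may have been truncated.
    (∀ᶠ ∀ᶠ sub 1F (4 ↑ʳ x) ⇒ᶠ trace 3F 2F 1F 0F ⇒ᶠ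
      isZero 1F ∧ᶠ evaluates f (map (4 ↑ʳ_) xs) 0F ∨ᶠ
      (∃ᶠ ∃ᶠ isSucc 1F 3F ∧ᶠ trace 5F 4F 1F 0F ∧ᶠ evaluates g (1F ∷ 0F ∷ map (6 ↑ʳ_) xs) 2F))

evaluatesAll []       xs []       = ∀ᶠ 0F ≐ 0F
evaluatesAll (g ∷ gs) xs (z ∷ zs) = evaluates g xs z ∧ᶠ evaluatesAll gs xs zs

-- Semantics of the arithmetic formulas and soundness of evaluation

module Semantics {n : ℕ} (G : Graph n) where

  Leaf : Fin n → Set
  Leaf u = ∀ v w → edge G u v ≡ true → edge G u w ≡ true → v ≡ w

  Core Matched Sub Below IsSucc Same : Fin n → Fin n → Set
  Core u v    = edge G u v ≡ true × ¬ Leaf u × ¬ Leaf v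
  Matched u v = edge G u v ≡ true × (Leaf u ⊎ Leaf v)
  Sub u v     = ∀ w → Core w u → Core w v
  Below u v   = Sub u v × ¬ Sub v u
  IsSucc u v  = Below u v × (∀ w → Below w v → Sub w u)
  Same u v    = Sub u v × Sub v u

  IsZero : Fin n → Set
  IsZero v = ¬ ∃ λ u → IsSucc u v

  Trace : Fin n → Fin n → Fin n → Fin n → Set
  Trace p q u v = ∃ λ r → ∃ λ s → Core p r × Core r s × Core s q × IsSucc u r × IsSucc v s

  Evaluates    : ∀ {k} → PR k → Vec (Fin n) k → Fin n → Set
  EvaluatesAll : ∀ {k m} → Vec (PR k) m → Vec (Fin n) k → Vec (Fin n) m → Set

  Evaluates zer         us       v = IsZero v
  Evaluates succ        (u ∷ []) v = IsSucc u v
  Evaluates (proj i)    us       v = Same (lookup us i) v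
  Evaluates (comp f gs) us       v = ∃ λ ws → EvaluatesAll gs us ws × Evaluates f ws v
  Evaluates (prec f g)  (u ∷ us) v = ∃ λ p → ∃ λ q → Trace p q u v ×
    (∀ i w → Sub i u → Trace p q i w →
      IsZero i × Evaluates f us w ⊎
      ∃ λ i′ → ∃ λ w′ → IsSucc i′ i × Trace p q i′ w′ × Evaluates g (i′ ∷ w′ ∷ us) w)

  EvaluatesAll []       us []       = ⊤
  EvaluatesAll (g ∷ gs) us (w ∷ ws) = Evaluates g us w × EvaluatesAll gs us ws

  Holds-∃* : ∀ {k} m (φ : Formula (m + k)) {ρ} → Holds G ρ (∃* m φ) ⇔ ∃ λ ws → Holds G (ws ++ ρ) φ
  Holds-∃* zero    φ = mk⇔ ([] ,_) λ { ([] , h) → h }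
  Holds-∃* (suc m) φ = mk⇔
    (λ h → let ws , w , h′ = to (Holds-∃* m (∃ᶠ φ)) h in w ∷ ws , h′)
    λ { (w ∷ ws , h) → from (Holds-∃* m (∃ᶠ φ)) (ws , w , h) }

  map-lookup-↑ʳ : ∀ {c k m} (ws : Vec (Fin n) m) {ρ : Vec (Fin n) c} {xs : Vec (Fin c) k} {us} →
    map (lookup ρ) xs ≡ us → map (lookup (ws ++ ρ)) (map (m ↑ʳ_) xs) ≡ us
  map-lookup-↑ʳ ws {ρ} {xs} eq =
    trans (sym (Vec.map-∘ _ _ xs)) (trans (Vec.map-cong (Vec.lookup-++ʳ ws ρ) xs) eq)

  map-lookup-bound : ∀ {c m} (ws : Vec (Fin n) m) {ρ : Vec (Fin n) c} →
    map (lookup (ws ++ ρ)) (bound m c) ≡ ws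
  map-lookup-bound {m = m} ws {ρ} =
    trans (sym (Vec.map-∘ _ _ (allFin m)))
      (trans (Vec.map-cong (Vec.lookup-++ˡ ws ρ) (allFin m)) (Vec.map-lookup-allFin ws))

  -- The values of the variables are given by equations, so that recursive calls under further
  -- quantifiers only need the lookup lemmas for extended environments.
  Holds-evaluates : ∀ {k c} (f : PR k) {ρ : Vec (Fin n) c} {xs y us v} →
    map (lookup ρ) xs ≡ us → lookup ρ y ≡ v → Holds G ρ (evaluates f xs y) ⇔ Evaluates f us v
  Holds-evaluatesAll : ∀ {k c m} (gs : Vec (PR k) m) {ρ : Vec (Fin n) c} {xs ys us vs} →
    map (lookup ρ) xs ≡ us → map (lookup ρ) ys ≡ vs → Holds G ρ (evaluatesAll gs xs ys) ⇔ EvaluatesAll gs us vs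

  Holds-evaluates zer refl refl = mk⇔ (λ h → h) (λ h → h)
  Holds-evaluates succ {xs = x ∷ []} refl refl = mk⇔ (λ h → h) (λ h → h)
  Holds-evaluates (proj i) {ρ} {xs} refl refl rewrite Vec.lookup-map i (lookup ρ) xs = mk⇔ (λ h → h) (λ h → h)
  Holds-evaluates {c = c} (comp {m} f gs) {ρ} {xs} {y} us≡ v≡ = mk⇔
    (λ h → let ws , hgs , hf = to (Holds-∃* m matrix) h in
      ws , to (args ws) hgs , to (result ws) hf)
    λ (ws , egs , ef) → from (Holds-∃* m matrix) (ws , from (args ws) egs , from (result ws) ef)
    where
    matrix = evaluatesAll gs (map (m ↑ʳ_) xs) (bound m c) ∧ᶠ evaluates f (bound m c) (m ↑ʳ y)
    args = λ ws → Holds-evaluatesAll gs (map-lookup-↑ʳ ws {ρ} {xs} us≡) (map-lookup-bound ws)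
    result = λ ws → Holds-evaluates f (map-lookup-bound ws) (trans (Vec.lookup-++ʳ ws ρ y) v≡)
  Holds-evaluates (prec f g) {ρ} {x ∷ xs} {y} {us = u ∷ us} us≡ refl with Vec.∷-injective us≡
  ... | refl , us≡ = mk⇔
    (λ (p , q , tr , h) → p , q , tr , λ i w i≤u ti → case h i w i≤u ti of λ where
      (inj₁ (z , hf)) → inj₁ (z , to (base p q i w) hf)
      (inj₂ (i′ , w′ , s , t , hg)) → inj₂ (i′ , w′ , s , t , to (step p q i w i′ w′) hg))
    (λ (p , q , tr , h) → p , q , tr , λ i w i≤u ti → case h i w i≤u ti of λ where
      (inj₁ (z , hf)) → inj₁ (z , from (base p q i w) hf)
      (inj₂ (i′ , w′ , s , t , hg)) → inj₂ (i′ , w′ , s , t , from (step p q i w i′ w′) hg))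
    where
    base = λ p q i w →
      Holds-evaluates f {ρ = w ∷ i ∷ q ∷ p ∷ ρ} {y = 0F} (map-lookup-↑ʳ (w ∷ i ∷ q ∷ p ∷ []) {ρ} {xs} us≡) refl
    step = λ p q i w i′ w′ →
      Holds-evaluates g {ρ = w′ ∷ i′ ∷ w ∷ i ∷ q ∷ p ∷ ρ} {y = 2F}
        (cong (λ us → i′ ∷ w′ ∷ us) (map-lookup-↑ʳ (w′ ∷ i′ ∷ w ∷ i ∷ q ∷ p ∷ []) {ρ} {xs} us≡)) refl

  Holds-evaluatesAll [] {ys = []} _ refl = mk⇔ (λ _ → tt) (λ _ _ → refl)
  Holds-evaluatesAll (g ∷ gs) {ys = y ∷ ys} us≡ refl = mk⇔
    (λ (h , hs) → to (Holds-evaluates g us≡ refl) h , to (Holds-evaluatesAll gs us≡ refl) hs)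
    (λ (h , hs) → from (Holds-evaluates g us≡ refl) h , from (Holds-evaluatesAll gs us≡ refl) hs)

  IsNum : Fin n → ℕ → Set
  IsNum v zero    = IsZero v
  IsNum v (suc m) = ∃ λ u → IsSucc u v × IsNum u m

  Holds-numeral : ∀ {k} m {v} {ρ : Vec (Fin n) k} → Holds G (v ∷ ρ) (numeral m) ⇔ IsNum v m
  Holds-numeral zero    = mk⇔ (λ h → h) (λ h → h)
  Holds-numeral (suc m) = mk⇔
    (λ (u , s , h) → u , s , to (Holds-numeral m) h)
    (λ (u , s , h) → u , s , from (Holds-numeral m) h)

  Sub-trans : ∀ {u v w} → Sub u v → Sub v w → Sub u w
  Sub-trans p q x c = q x (p x c)

  Below-wellFounded : WellFounded Below
  Below-wellFounded = spo-wellFounded record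
    { isEquivalence = isEquivalence
    ; irrefl        = λ { refl (p , ¬p) → ¬p p }
    ; trans         = λ (p , ¬p) (q , ¬q) → Sub-trans p q , λ r → ¬p (Sub-trans q r)
    ; <-resp-≈      = (λ { refl b → b }) , (λ { refl b → b })
    }

  IsSucc-respʳ : ∀ {u v w} → Same v w → IsSucc u v → IsSucc u w
  IsSucc-respʳ (vw , wv) ((uv , ¬vu) , max) =
    (Sub-trans uv vw , λ wu → ¬vu (Sub-trans vw wu)) ,
    λ x (xw , ¬wx) → max x (Sub-trans xw wv , λ vx → ¬wx (Sub-trans wv vx))

  IsSucc-respˡ : ∀ {u v w} → Same u v → IsSucc u w → IsSucc v w
  IsSucc-respˡ (uv , vu) ((uw , ¬wu) , max) =
    (Sub-trans vu uw , λ wv → ¬wu (Sub-trans wv vu)) , λ x b → Sub-trans (max x b) uv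

  -- Each of the two lies below `v`, hence is included in the other by maximality.
  IsSucc-unique : ∀ {u u′ v} → IsSucc u v → IsSucc u′ v → Same u u′
  IsSucc-unique (b , max) (b′ , max′) = max′ _ b , max _ b′

  Same-sym : ∀ {u v} → Same u v → Same v u
  Same-sym (p , q) = q , p

  IsNum-resp : ∀ m {u v} → Same u v → IsNum u m → IsNum v m
  IsNum-resp zero    same z           (w , s) = z (w , IsSucc-respʳ (Same-sym same) s)
  IsNum-resp (suc m) same (w , s , h)         = w , IsSucc-respʳ same s , h

  IsNum-pred : ∀ {m u v} → IsSucc u v → IsNum v m → ∃ λ m′ → m ≡ suc m′ × IsNum u m′
  IsNum-pred {zero}  s z            = ⊥-elim (z (_ , s))
  IsNum-pred {suc m} s (u , s′ , h) = m , refl , IsNum-resp m (IsSucc-unique s′ s) h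

  IsNum-zero : ∀ {m v} → IsZero v → IsNum v m → m ≡ 0
  IsNum-zero {zero}  z _           = refl
  IsNum-zero {suc m} z (u , s , _) = ⊥-elim (z (u , s))

  -- Descend along predecessors until there is none; finiteness makes the descent stop and the
  -- existence of a predecessor decidable. Thus any vertex found by a search yields an actual
  -- natural number.
  isNum : ∀ v → ∃ (IsNum v)
  isNum v = go v (Below-wellFounded v)
    where
    go : ∀ v → Acc Below v → ∃ (IsNum v)
    cases : ∀ v → (∀ {u} → Below u v → Acc Below u) → Dec (∃ λ u → IsSucc u v) → ∃ (IsNum v)
    go v (acc rs) = cases v rs (Holds? G (v ∷ []) (∃ᶠ isSucc 0F 1F))
    cases v rs (no  z)       = 0 , z
    cases v rs (yes (u , s)) = let m , h = go u (rs (proj₁ s)) in suc m , u , s , h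

  -- For `prec`, the induction is on the number of the index and follows the justifications
  -- downwards. That number decides which disjunct can hold, and the index stays included in `u`, so
  -- each earlier entry is justified as well.
  evaluates-sound    : ∀ {k} (f : PR k) {us v ms} → Pointwise IsNum us ms → Evaluates f us v → IsNum v (eval f ms)
  evaluatesAll-sound : ∀ {k m} (gs : Vec (PR k) m) {us vs ms} → Pointwise IsNum us ms →
    EvaluatesAll gs us vs → Pointwise IsNum vs (evalAll gs ms)

  evaluates-sound zer         us∼ms          z                = z
  evaluates-sound succ        (u∼m ∷ [])     s                = _ , s , u∼m
  evaluates-sound (proj i)    us∼ms          same             = IsNum-resp _ same (Pointwise.lookup us∼ms i)
  evaluates-sound (comp f gs) us∼ms          (ws , egs , ef)  =
    evaluates-sound f (evaluatesAll-sound gs us∼ms egs) ef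
  evaluates-sound (prec f g) {u ∷ us} {v} {m ∷ ms} (u∼m ∷ us∼ms) (p , q , tr , justified) =
    go m u v u∼m (λ _ c → c) tr
    where
    go : ∀ m i w → IsNum i m → Sub i u → Trace p q i w → IsNum w (eval (prec f g) (m ∷ ms))
    go m i w i∼m i≤u ti with justified i w i≤u ti
    ... | inj₁ (z , ef) with refl ← IsNum-zero {m} z i∼m = evaluates-sound f us∼ms ef
    ... | inj₂ (i′ , w′ , s , t , eg) with m′ , refl , i′∼m′ ← IsNum-pred {m} s i∼m =
      subst (IsNum w) (sym (eval-prec-suc f g ms m′))
        (evaluates-sound g (i′∼m′ ∷ go m′ i′ w′ i′∼m′ (Sub-trans (proj₁ (proj₁ s)) i≤u) t ∷ us∼ms) eg)

  evaluatesAll-sound []       {vs = []}     us∼ms _        = []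
  evaluatesAll-sound (g ∷ gs) {vs = v ∷ vs} us∼ms (e , es) =
    evaluates-sound g us∼ms e ∷ evaluatesAll-sound gs us∼ms es

open Semantics

-- Unbounded search and the parity constraint

search : PR 2 → Formula 1
search f = ∃ᶠ ∃ᶠ evaluates f (2F ∷ 1F ∷ []) 0F ∧ᶠ isZero 0F

search-sound : ∀ {n} (G : Graph n) f {u m} → IsNum G u m → Holds G (u ∷ []) (search f) →
  ∃ λ t → eval f (m ∷ t ∷ []) ≡ 0
search-sound G f u∼m (v , w , h , z) =
  let t , v∼t = isNum G v in
  t , IsNum-zero G z (evaluates-sound G f (u∼m ∷ v∼t ∷ []) (to (Holds-evaluates G f refl refl) h))

-- First-order logic cannot quantify over a set of edges, so the matching is fixed as the set of
-- edges with a leaf at one end.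
perfectMatching : Formula 0
perfectMatching = ∀ᶠ ∃ᶠ matched 1F 0F ∧ᶠ (∀ᶠ matched 2F 0F ⇒ᶠ 0F ≐ 1F)

sum-const-1 : ∀ n → sum {n} (λ _ → 1) ≡ n
sum-const-1 zero    = refl
sum-const-1 (suc n) = cong suc (sum-const-1 n)

-- Exactly half of the points of a fixed-point-free involution are smaller than their partner.
involution-even : ∀ {n} (f : Fin n → Fin n) → (∀ i → f (f i) ≡ i) → (∀ i → f i ≢ i) → ∃ λ m → n ≡ m + m
involution-even {n} f inv noFix = sum less , (begin
  n                                        ≡⟨ sym (sum-const-1 n) ⟩
  sum {n} (λ _ → 1)                        ≡⟨ sum-cong-≗ (λ i → sym (one i)) ⟩
  sum (λ i → less i + less (f i))          ≡⟨ ∑-distrib-+ less (less ∘ f) ⟩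
  sum less + sum (less ∘ f)                ≡⟨ cong (sum less +_) (sym (sum-permute less π)) ⟩
  sum less + sum less                      ∎)
  where
  open ≡-Reasoning
  π : Permutation′ n
  π = permutation f f inv inv
  indicator : ∀ {P : Set} → Dec P → ℕ
  indicator (yes _) = 1
  indicator (no _)  = 0
  less : Fin n → ℕ
  less i = indicator (i Fin.<? f i)
  one : ∀ i → less i + less (f i) ≡ 1
  one i rewrite inv i with Fin.<-cmp i (f i) | i Fin.<? f i | f i Fin.<? i
  ... | tri≈ _ eq _  | _      | _      = ⊥-elim (noFix i (sym eq))
  ... | _            | yes p  | yes q  = ⊥-elim (Fin.<-asym p q)
  ... | _            | yes _  | no _   = refl
  ... | _            | no _   | yes _  = refl
  ... | tri< p _ _   | no ¬p  | no _   = ⊥-elim (¬p p)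
  ... | tri> _ _ q   | no _   | no ¬q  = ⊥-elim (¬q q)

-- The partner map is an involution as `Matched` is symmetric with unique partners, and has no fixed
-- point as there are no loops.
perfectMatching-even : ∀ {n} (G : Graph n) → Holds G [] perfectMatching → ∃ λ m → n ≡ m + m
perfectMatching-even G h = involution-even f
  (λ u → sym (unique (f u) u (matched-sym (f-matched u))))
  (λ u eq → case trans (sym (edge-irrefl G u)) (subst (λ v → edge G u v ≡ true) eq (proj₁ (f-matched u))) of λ ())
  where
  f = λ u → proj₁ (h u)
  f-matched = λ u → proj₁ (proj₂ (h u))
  unique = λ u → proj₂ (proj₂ (h u))
  matched-sym : ∀ {u v} → Matched G u v → Matched G v u
  matched-sym {u} {v} (e , inj₁ l) = trans (edge-sym G v u) e , inj₂ l
  matched-sym {u} {v} (e , inj₂ l) = trans (edge-sym G v u) e , inj₁ l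

-- Models containing the numbers 0 … M and all traces among them

-- The core has a half graph: α i is adjacent to β j for j < i, so that the neighbourhoods of the
-- α i form a chain. A function f is traced by the paths π false f – ε false f i – ε true f i –
-- π true f, where the two inner vertices see the same β as α i and α (f i). The vertex δ keeps the
-- neighbourhoods of β and π from being included in those of α and ε.
module Model (M : ℕ) where

  N : ℕ
  N = suc M

  Fun : Set
  Fun = Fin (N ^ N)

  V : Set
  V = Fin N ⊎ Fin N ⊎ (Bool × Fun) ⊎ (Bool × Fun × Fin N) ⊎ ⊤

  pattern α i     = inj₁ i
  pattern β j     = inj₂ (inj₁ j)
  pattern π s f   = inj₂ (inj₂ (inj₁ (s , f)))
  pattern ε s f i = inj₂ (inj₂ (inj₂ (inj₁ (s , f , i))))
  pattern δ       = inj₂ (inj₂ (inj₂ (inj₂ tt)))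

  _≟ⱽ_ : DecidableEquality V
  _≟ⱽ_ = Sum.≡-dec Fin._≟_ (Sum.≡-dec Fin._≟_ (Sum.≡-dec (Product.≡-dec Bool._≟_ Fin._≟_)
    (Sum.≡-dec (Product.≡-dec Bool._≟_ (Product.≡-dec Fin._≟_ Fin._≟_)) Unit._≟_)))

  value : Bool → Fun → Fin N → Fin N
  value false f i = i
  value true  f i = finToFun f i

  -- The number of `β` neighbours, which is the number that an `α` or `ε` vertex stands for.
  height : V → ℕ
  height (α i)     = toℕ i
  height (ε s f i) = toℕ (value s f i)
  height _         = 0

  owner : V → Maybe (Bool × Fun)
  owner (ε s f i) = just (s , f)
  owner _         = nothing

  capped : V → Bool
  capped (β j)   = true
  capped (π s f) = true
  capped _       = false

  Link : V → V → Set
  Link (α i)     v = ⊥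
  Link (β j)     v = toℕ j < height v
  Link (π s f)   v = owner v ≡ just (s , f)
  Link (ε s f i) v = v ≡ ε (not s) f i
  Link δ         v = capped v ≡ true

  link? : ∀ u v → Dec (Link u v)
  link? (α i)     v = no λ ()
  link? (β j)     v = toℕ j <? height v
  link? (π s f)   v = Maybe.≡-dec (Product.≡-dec Bool._≟_ Fin._≟_) (owner v) (just (s , f))
  link? (ε s f i) v = v ≟ⱽ ε (not s) f i
  link? δ         v = capped v Bool.≟ true

  Link-irrefl : ∀ v → ¬ Link v v
  Link-irrefl (ε true  f i) ()
  Link-irrefl (ε false f i) ()

  Adj : V → V → Set
  Adj u v = Link u v ⊎ Link v u

  adj? : ∀ u v → Dec (Adj u v)
  adj? u v = link? u v ⊎-dec link? v u

  Adj-irrefl : ∀ v → ¬ Adj v v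
  Adj-irrefl v (inj₁ l) = Link-irrefl v l
  Adj-irrefl v (inj₂ l) = Link-irrefl v l

  _⊑_ : V → V → Set
  u ⊑ v = ∀ w → Adj w u → Adj w v

  Adj-α : ∀ w i → Adj w (α i) → ∃ λ j → w ≡ β j × toℕ j < toℕ i
  Adj-α (β j) i (inj₁ lt) = j , refl , lt
  Adj-α (ε s f k) i (inj₁ ())
  Adj-α δ i (inj₁ ())

  α-mono : ∀ {i j} → toℕ i ≤ toℕ j → α i ⊑ α j
  α-mono {i} i≤j w a with k , refl , lt ← Adj-α w i a = inj₁ (<-≤-trans lt i≤j)

  -- If `height v < i`, then `β` at index `height v` is a neighbour of `α i` but not of `v`.
  α-cancel : ∀ {i v} → (∀ j → Adj (β j) v → toℕ j < height v) → α i ⊑ v → toℕ i ≤ height v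
  α-cancel {i} {v} βs sub = ≮⇒≥ λ lt →
    let j  = fromℕ< (<-trans lt (Fin.toℕ<n i))
        j≡ = Fin.toℕ-fromℕ< (<-trans lt (Fin.toℕ<n i))
    in <-irrefl j≡ (βs j (sub (β j) (inj₁ (subst (_< toℕ i) (sym j≡) lt))))

  βs-α : ∀ {i} j → Adj (β j) (α i) → toℕ j < toℕ i
  βs-α j (inj₁ lt) = lt

  βs-ε : ∀ {s f i} j → Adj (β j) (ε s f i) → toℕ j < toℕ (value s f i)
  βs-ε j (inj₁ lt) = lt

  -- The counterpart of `IsSucc` on the core, before its vertices are enumerated.
  _◁_ : V → V → Set
  u ◁ v = (u ⊑ v × ¬ v ⊑ u) × (∀ w → w ⊑ v × ¬ v ⊑ w → w ⊑ u)

  someFun : Fun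
  someFun = funToFin {N} {N} (λ i → i)

  -- Only `α` vertices can be included in `α i′`: all others have a neighbour that is not a `β`,
  -- namely `δ` for `β` and `π`, and some `π` for `ε` and `δ`.
  α◁α : ∀ {i i′} → toℕ i′ ≡ suc (toℕ i) → α i ◁ α i′
  α◁α {i} {i′} i′≡ =
    (α-mono (≤-trans (n≤1+n _) (≤-reflexive (sym i′≡))) ,
     λ sub → <-irrefl refl (≤-trans (≤-reflexive (sym i′≡)) (α-cancel {i′} {α i} (βs-α {i}) sub))) , max
    where
    max : ∀ w → w ⊑ α i′ × ¬ α i′ ⊑ w → w ⊑ α i
    max (α k) (_ , ¬sub) = α-mono (≤-pred (≤-trans (≰⇒> (λ le → ¬sub (α-mono le))) (≤-reflexive i′≡)))
    max (β j) (sub , _) with _ , () , _ ← Adj-α δ i′ (sub δ (inj₁ refl))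
    max (π s f) (sub , _) with _ , () , _ ← Adj-α δ i′ (sub δ (inj₁ refl))
    max (ε s f k) (sub , _) with _ , () , _ ← Adj-α (π s f) i′ (sub (π s f) (inj₁ refl))
    max δ (sub , _) with _ , () , _ ← Adj-α (π true someFun) i′ (sub (π true someFun) (inj₂ refl))

  -- The only `ε` neighbour of an `ε` vertex is its partner with the opposite sign, so the partner
  -- determines the vertex.
  partner-injective : ∀ s s′ f f′ k k′ → Adj (ε (not s′) f′ k′) (ε s f k) →
    _≡_ {A = V} (ε s′ f′ k′) (ε s f k)
  partner-injective true  true  f f′ k k′ (inj₁ refl) = refl
  partner-injective false false f f′ k k′ (inj₁ refl) = refl
  partner-injective true  true  f f′ k k′ (inj₂ refl) = refl
  partner-injective false false f f′ k k′ (inj₂ refl) = refl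

  -- Besides its `β` neighbours, `ε s f k` sees only `π s f` and its partner. This excludes `β` and
  -- `π`, which see `δ`, and any other `ε`, which has another partner; an `α` below is bounded by
  -- its height.
  α◁ε : ∀ s f k → α (value s f k) ◁ ε s f k
  α◁ε s f k =
    ((λ w a → case Adj-α w (value s f k) a of λ { (_ , refl , lt) → inj₁ lt }) ,
     λ sub → case Adj-α (π s f) (value s f k) (sub (π s f) (inj₁ refl)) of λ { (_ , () , _) }) , max
    where
    not≢ : ∀ {s} → ¬ just (s , f) ≡ just (not s , f)
    not≢ {true}  ()
    not≢ {false} ()
    max : ∀ w → w ⊑ ε s f k × ¬ ε s f k ⊑ w → w ⊑ α (value s f k)
    max (α i) (sub , _) = α-mono (α-cancel {i} {ε s f k} (βs-ε {s} {f} {k}) sub)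
    max (β j) (sub , _) with sub δ (inj₁ refl)
    ... | inj₁ ()
    ... | inj₂ ()
    max (π s′ f′) (sub , _) with sub δ (inj₁ refl)
    ... | inj₁ ()
    ... | inj₂ ()
    max (ε s′ f′ k′) (sub , ¬sub) =
      ⊥-elim (¬sub (subst (ε s f k ⊑_)
        (sym (partner-injective s s′ f f′ k k′ (sub (ε (not s′) f′ k′) (inj₂ refl)))) (λ _ a → a)))
    -- `δ` sees the `π` of both signs, whereas `ε s f k` sees only the one of its own sign.
    max δ (sub , _) with sub (π (not s) f) (inj₂ refl)
    ... | inj₁ eq = ⊥-elim (not≢ eq)
    ... | inj₂ ()

  -- One pendant leaf (v , true) per core vertex v gives a perfect matching definable from leaves.
  V⁺ : Set
  V⁺ = V × Bool

  Adjacent : V⁺ → V⁺ → Set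
  Adjacent (u , false) (v , false) = Adj u v
  Adjacent (u , false) (v , true)  = u ≡ v
  Adjacent (u , true)  (v , false) = u ≡ v
  Adjacent (u , true)  (v , true)  = ⊥

  adjacent? : ∀ u v → Dec (Adjacent u v)
  adjacent? (u , false) (v , false) = adj? u v
  adjacent? (u , false) (v , true)  = u ≟ⱽ v
  adjacent? (u , true)  (v , false) = u ≟ⱽ v
  adjacent? (u , true)  (v , true)  = no λ ()

  Adjacent-irrefl : ∀ v → ¬ Adjacent v v
  Adjacent-irrefl (v , false) = Adj-irrefl v

  Adjacent-sym : ∀ u v → Adjacent u v → Adjacent v u
  Adjacent-sym (u , false) (v , false) = swap
  Adjacent-sym (u , false) (v , true)  = sym
  Adjacent-sym (u , true)  (v , false) = sym

  -- The summands count the `α`, `β`, `π`, `ε` and `δ` vertices; the factor 2 accounts for the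
  -- pendant leaves.
  size : ℕ
  size = (N + (N + (2 * N ^ N + (2 * (N ^ N * N) + 1)))) * 2

  M≤size : M ≤ size
  M≤size = ≤-trans (n≤1+n M) (≤-trans (m≤m+n N _) (m≤m*n _ 2))

  _⟨+⟩_ : ∀ {k l} {A B : Set} → Fin k ↔ A → Fin l ↔ B → Fin (k + l) ↔ (A ⊎ B)
  e ⟨+⟩ e′ = (e ⊎-↔ e′) ↔-∘ Fin.+↔⊎

  _⟨*⟩_ : ∀ {k l} {A B : Set} → Fin k ↔ A → Fin l ↔ B → Fin (k * l) ↔ (A × B)
  e ⟨*⟩ e′ = (e ×-↔ e′) ↔-∘ Fin.*↔×

  abstract
    enumeration : Fin size ↔ V⁺
    enumeration =
      (↔-id (Fin N) ⟨+⟩ (↔-id (Fin N) ⟨+⟩ ((Fin.2↔Bool ⟨*⟩ ↔-id Fun) ⟨+⟩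
        ((Fin.2↔Bool ⟨*⟩ (↔-id Fun ⟨*⟩ ↔-id (Fin N))) ⟨+⟩ Fin.1↔⊤))))
        ⟨*⟩ Fin.2↔Bool

  open Inverse enumeration using () renaming (to to point; from to vertex)

  point-vertex : ∀ v → point (vertex v) ≡ v
  point-vertex = Inverse.strictlyInverseˡ enumeration

  point-injective : ∀ {x y} → point x ≡ point y → x ≡ y
  point-injective {x} {y} eq = trans (sym (Inverse.strictlyInverseʳ enumeration x))
    (trans (cong vertex eq) (Inverse.strictlyInverseʳ enumeration y))

  G : Graph size
  G = graph (λ x y → does (adjacent? (point x) (point y)))

  edge-G : ∀ x y → edge G x y ≡ does (adjacent? (point x) (point y))
  edge-G = edge-graph
    (λ x → dec-false (adjacent? (point x) (point x)) (Adjacent-irrefl (point x)))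
    (λ x y → does-⇔ (adjacent? (point x) (point y)) (adjacent? (point y) (point x))
               (Adjacent-sym (point x) (point y)) (Adjacent-sym (point y) (point x)))
    where
    does-⇔ : ∀ {A B : Set} (a? : Dec A) (b? : Dec B) → (A → B) → (B → A) → does a? ≡ does b?
    does-⇔ (yes a) b? f g = sym (dec-true b? (f a))
    does-⇔ (no ¬a) b? f g = sym (dec-false b? (¬a ∘ g))

  edge⇒ : ∀ x y → edge G x y ≡ true → Adjacent (point x) (point y)
  edge⇒ x y e with adjacent? (point x) (point y) | edge-G x y
  ... | yes a | _  = a
  ... | no _  | eq = case trans (sym e) eq of λ ()

  edge⇐ : ∀ x y → Adjacent (point x) (point y) → edge G x y ≡ true
  edge⇐ x y a = trans (edge-G x y) (dec-true (adjacent? (point x) (point y)) a)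

  leaf⁺ : ∀ x {v} → point x ≡ (v , true) → Leaf G x
  leaf⁺ x {v} eq y z exy exz = point-injective (trans (only y (edge⇒ x y exy)) (sym (only z (edge⇒ x z exz))))
    where
    only : ∀ y → Adjacent (point x) (point y) → point y ≡ (v , false)
    only y a rewrite eq with point y
    ... | w , false = cong (_, false) (sym a)

  -- A core neighbour and the pendant leaf are two distinct neighbours. An isolated core vertex such
  -- as `α 0F` is itself a leaf, hence the assumption `Adj v w`.
  leaf⁻ : ∀ x {v w} → point x ≡ (v , false) → Adj v w → ¬ Leaf G x
  leaf⁻ x {v} {w} eq a leaf =
    case trans (sym (point-vertex (w , false))) (trans (cong point y≡z) (point-vertex (v , true))) of λ ()
    where
    y≡z = leaf (vertex (w , false)) (vertex (v , true))
      (edge⇐ x (vertex (w , false)) (subst₂ Adjacent (sym eq) (sym (point-vertex (w , false))) a))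
      (edge⇐ x (vertex (v , true)) (subst₂ Adjacent (sym eq) (sym (point-vertex (v , true))) refl))

  -- Pendant vertices behave like the isolated vertex α 0 of the core.
  strip : V⁺ → V
  strip (v , false) = v
  strip (v , true)  = α 0F

  base : Fin size → V
  base x = strip (point x)

  core⇒ : ∀ x y → Core G x y → Adj (base x) (base y)
  core⇒ x y (e , ¬lx , ¬ly) with point x in eqx | point y in eqy | edge⇒ x y e
  ... | u , false | v , false | a = a
  ... | u , true  | _         | _ = ⊥-elim (¬lx (leaf⁺ x eqx))
  ... | u , false | v , true  | _ = ⊥-elim (¬ly (leaf⁺ y eqy))

  ¬Adj-α0 : ∀ v → ¬ Adj v (α 0F)
  ¬Adj-α0 v a with _ , _ , () ← Adj-α v 0F a

  -- Adjacency in the core makes both ends non-leaves, and a pendant vertex cannot occur since its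
  -- base `α 0F` has no neighbours.
  core⇐ : ∀ x y → Adj (base x) (base y) → Core G x y
  core⇐ x y a with point x in eqx | point y in eqy
  ... | u , false | v , false =
    edge⇐ x y (subst₂ Adjacent (sym eqx) (sym eqy) a) , leaf⁻ x {u} {v} eqx a , leaf⁻ y {v} {u} eqy (swap a)
  ... | u , true  | v         = ⊥-elim (¬Adj-α0 (strip v) (swap a))
  ... | u , false | v , true  = ⊥-elim (¬Adj-α0 u a)

  vert : V → Fin size
  vert v = vertex (v , false)

  base-vert : ∀ v → base (vert v) ≡ v
  base-vert v = cong strip (point-vertex (v , false))

  Sub⇒ : ∀ x y → Sub G x y → base x ⊑ base y
  Sub⇒ x y sub w a = subst (λ w → Adj w (base y)) (base-vert w)
    (core⇒ (vert w) y (sub (vert w) (core⇐ (vert w) x (subst (λ w → Adj w (base x)) (sym (base-vert w)) a))))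

  Sub⇐ : ∀ x y → base x ⊑ base y → Sub G x y
  Sub⇐ x y sub w c = core⇐ w y (sub (base w) (core⇒ w x c))

  IsSucc⇐ : ∀ x y → base x ◁ base y → IsSucc G x y
  IsSucc⇐ x y ((p , ¬p) , max) = (Sub⇐ x y p , λ s → ¬p (Sub⇒ y x s)) ,
    λ w (q , ¬q) → Sub⇐ w x (max (base w) (Sub⇒ w y q , λ s → ¬q (Sub⇐ y w s)))

  num : Fin N → Fin size
  num i = vert (α i)

  num-succ : ∀ i i′ → toℕ i′ ≡ suc (toℕ i) → IsSucc G (num i) (num i′)
  num-succ i i′ eq = IsSucc⇐ (num i) (num i′)
    (subst₂ _◁_ (sym (base-vert (α i))) (sym (base-vert (α i′))) (α◁α {i} {i′} eq))

  value-succ : ∀ r s f k → base r ≡ ε s f k → IsSucc G (num (value s f k)) r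
  value-succ r s f k eq = IsSucc⇐ (num (value s f k)) r
    (subst₂ _◁_ (sym (base-vert (α (value s f k)))) (sym eq) (α◁ε s f k))

  num-zero : IsZero G (num 0F)
  num-zero (u , (_ , ¬sub) , _) =
    ¬sub (Sub⇐ (num 0F) u (λ w a → ⊥-elim (¬Adj-α0 w (subst (Adj w) (base-vert (α 0F)) a))))

  num-cancel : ∀ i j → Sub G (num i) (num j) → toℕ i ≤ toℕ j
  num-cancel i j sub = α-cancel {i} {α j} (βs-α {j})
    (subst₂ _⊑_ (base-vert (α i)) (base-vert (α j)) (Sub⇒ (num i) (num j) sub))

  module _ (f : Fun) where

    p q : V
    p = π false f
    q = π true f

    TraceOf : Fin size → Fin size → Set
    TraceOf = Trace G (vert p) (vert q)

    -- A neighbour of `π false f` is `δ` or some `ε false f k`. From `δ` one reaches only `β` and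
    -- `π` vertices, none adjacent to `π true f`; from `ε false f k` only the partner is adjacent to
    -- it.
    middle : ∀ r s → Adj (π false f) r → Adj r s → Adj s (π true f) →
      ∃ λ k → r ≡ ε false f k × s ≡ ε true f k
    middle (ε .false .f k) (ε _ _ _) (inj₁ refl) (inj₁ refl) _ = k , refl , refl
    middle (ε .false .f k) (ε true .f _) (inj₁ refl) (inj₂ refl) _ = k , refl , refl
    middle (ε .false .f k) δ (inj₁ refl) (inj₁ ()) _
    middle (ε .false .f k) δ (inj₁ refl) (inj₂ ()) _
    middle (ε .false .f k) (β _) (inj₁ refl) (inj₂ _) (inj₁ ())
    middle (ε .false .f k) (β _) (inj₁ refl) (inj₂ _) (inj₂ ())
    middle (ε .false .f k) (π _ _) (inj₁ refl) (inj₂ _) (inj₁ ())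
    middle (ε .false .f k) (π _ _) (inj₁ refl) (inj₂ _) (inj₂ ())
    middle δ (ε _ _ _) _ (inj₁ ()) _
    middle δ (ε _ _ _) _ (inj₂ ()) _
    middle δ δ _ (inj₁ ()) _
    middle δ δ _ (inj₂ ()) _
    middle δ (β _) _ _ (inj₁ ())
    middle δ (β _) _ _ (inj₂ ())
    middle δ (π _ _) _ _ (inj₁ ())
    middle δ (π _ _) _ _ (inj₂ ())

    trace⇒ : ∀ {x y} → TraceOf x y → ∃ λ k → Same G x (num k) × Same G y (num (finToFun f k))
    trace⇒ {x} {y} (r , s , pr , rs , sq , xr , ys) =
      let k , r≡ , s≡ = middle (base r) (base s)
            (subst (λ v → Adj v (base r)) (base-vert p) (core⇒ (vert p) r pr)) (core⇒ r s rs)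
            (subst (Adj (base s)) (base-vert q) (core⇒ s (vert q) sq))
      in k , IsSucc-unique G xr (value-succ r false f k r≡) , IsSucc-unique G ys (value-succ s true f k s≡)

    trace⇐ : ∀ {x y} k → Same G x (num k) → Same G y (num (finToFun f k)) → TraceOf x y
    trace⇐ k x∼ y∼ = vert (ε false f k) , vert (ε true f k) ,
      between p r (inj₁ refl) , between r s (inj₁ refl) , between s q (inj₂ refl) ,
      IsSucc-respˡ G (Same-sym G x∼) (value-succ (vert r) false f k (base-vert r)) ,
      IsSucc-respˡ G (Same-sym G y∼) (value-succ (vert s) true f k (base-vert s))
      where
      r s : V
      r = ε false f k
      s = ε true f k
      between : ∀ u v → Adj u v → Core G (vert u) (vert v)
      between u v a = core⇐ (vert u) (vert v) (subst₂ Adj (sym (base-vert u)) (sym (base-vert v)) a)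

  hasPerfectMatching : Holds G [] perfectMatching
  hasPerfectMatching x = cases (point x) refl
    where
    Goal = ∃ λ y → Matched G x y × (∀ z → Matched G x z → z ≡ y)
    cases : ∀ v → point x ≡ v → Goal
    cases (v , true) eq = vert v , (e , inj₁ isLeaf) , λ z m → isLeaf z (vert v) (proj₁ m) e
      where
      isLeaf : Leaf G x
      isLeaf = leaf⁺ x eq
      e : edge G x (vert v) ≡ true
      e = edge⇐ x (vert v) (subst₂ Adjacent (sym eq) (sym (point-vertex (v , false))) refl)
    cases (v , false) eq =
      y , (edge⇐ x y (subst₂ Adjacent (sym eq) (sym y≡) refl) , inj₂ (leaf⁺ y y≡)) , unique
      where
      y = vertex (v , true)
      y≡ = point-vertex (v , true)
      unique : ∀ z → Matched G x z → z ≡ y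
      unique z (e , l) with point z in eqz | subst (λ v → Adjacent v (point z)) eq (edge⇒ x z e) | l
      ... | w , true  | a | _      = point-injective (trans eqz (trans (cong (_, true) (sym a)) (sym y≡)))
      -- Two adjacent core vertices are both non-leaves, so the edge between them is not a matched
      -- one.
      ... | w , false | a | inj₁ l = ⊥-elim (leaf⁻ x {v} {w} eq a l)
      ... | w , false | a | inj₂ l = ⊥-elim (leaf⁻ z {w} {v} eqz (swap a) l)

  ¬edgeless : ¬ Edgeless G
  ¬edgeless el = el (vertex (δ , false)) (vertex (δ , true))
    (edge⇐ (vertex (δ , false)) (vertex (δ , true))
      (subst₂ Adjacent (sym (point-vertex (δ , false))) (sym (point-vertex (δ , true))) refl))

open Model using (G; size; M≤size; num; num-succ; num-zero; num-cancel; vert; p; q; trace⇒; trace⇐;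
  hasPerfectMatching; ¬edgeless)

-- Representing numbers and functions in the models

module _ (M : ℕ) where

  -- Stronger than `IsNum`: reference to a concrete `α` carries the bound `m ≤ M` and determines the
  -- vertex up to equal core neighbourhoods.
  Represents : Fin (size M) → ℕ → Set
  Represents x m = ∃ λ i → toℕ i ≡ m × Same (G M) x (num M i)

  number : ∀ {m} → m ≤ M → ∃ λ x → Represents x m
  number m≤M = num M i , i , Fin.toℕ-fromℕ< (s≤s m≤M) , (λ _ c → c) , (λ _ c → c)
    where i = fromℕ< (s≤s m≤M)

  represents-same : ∀ {x y m} → Represents x m → Represents y m → Same (G M) x y
  represents-same (i , i≡ , si , is) (j , j≡ , sj , js) with refl ← Fin.toℕ-injective (trans i≡ (sym j≡)) =
    Sub-trans (G M) si js , Sub-trans (G M) sj is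

  represents-zero : ∀ {x} → Represents x 0 → IsZero (G M) x
  represents-zero (0F , _ , same) = IsNum-resp (G M) 0 (Same-sym (G M) same) (num-zero M)

  represents-succ : ∀ {x y m} → Represents x m → Represents y (suc m) → IsSucc (G M) x y
  represents-succ (i , i≡ , si) (j , j≡ , sj) =
    IsSucc-respˡ (G M) (Same-sym (G M) si) (IsSucc-respʳ (G M) (Same-sym (G M) sj)
      (num-succ M i j (trans j≡ (cong suc (sym i≡)))))

  represents-bound : ∀ {x m} → Represents x m → m ≤ M
  represents-bound (i , refl , _) = Fin.toℕ≤pred[n] i

  represents-sub : ∀ {x y m n} → Represents x m → Represents y n → Sub (G M) x y → m ≤ n
  represents-sub (i , refl , _ , is) (j , refl , sj , _) sub =
    num-cancel M i j (Sub-trans (G M) is (Sub-trans (G M) sub sj))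

  represents-isNum : ∀ m {x} → Represents x m → IsNum (G M) x m
  represents-isNum zero    r = represents-zero r
  represents-isNum (suc m) r =
    let y , r′ = number (≤-trans (n≤1+n m) (represents-bound r)) in
    y , represents-succ r′ r , represents-isNum m r′

  module _ (h : ℕ → ℕ) where

    -- The models code only functions from the numbers up to `M` to themselves, so larger values of
    -- `h` are cut off at `M`; the trace is faithful wherever `h` stays within the bound.
    clamp : Fin (suc M) → Fin (suc M)
    clamp i = fromℕ< (s≤s (m⊓n≤n (h (toℕ i)) M))

    clamp≡ : ∀ {i} → h (toℕ i) ≤ M → toℕ (finToFun (funToFin clamp) i) ≡ h (toℕ i)
    clamp≡ {i} le = trans (cong toℕ (Fin.finToFun-funToFin clamp i))
      (trans (Fin.toℕ-fromℕ< _) (m≤n⇒m⊓n≡m le))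

    hTrace : Fin (size M) → Fin (size M) → Set
    hTrace = Trace (G M) (vert M (p M (funToFin clamp))) (vert M (q M (funToFin clamp)))

    hTrace⁺ : ∀ {x y m} → Represents x m → Represents y (h m) → hTrace x y
    hTrace⁺ (i , refl , si) r@(j , j≡ , sj) = trace⇐ M (funToFin clamp) i si
      (subst (λ j → Same (G M) _ (num M j))
        (Fin.toℕ-injective (trans j≡ (sym (clamp≡ (represents-bound r))))) sj)

    hTrace⁻ : ∀ {x y} → hTrace x y → ∃ λ m → Represents x m × (h m ≤ M → Represents y (h m))
    hTrace⁻ t = let k , sx , sy = trace⇒ M (funToFin clamp) t in
      toℕ k , (k , refl , sx) , λ le → _ , clamp≡ le , sy

-- Completeness of evaluation in large models

Eventually : (ℕ → Set) → Set
Eventually P = ∃ λ B → ∀ M → B ≤ M → P M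

eventually-map₂ : ∀ {P Q R : ℕ → Set} → (∀ {M} → P M → Q M → R M) → Eventually P → Eventually Q → Eventually R
eventually-map₂ f (B , P) (C , Q) = B ⊔ C , λ M le →
  f (P M (≤-trans (m≤m⊔n B C) le)) (Q M (≤-trans (m≤n⊔m B C) le))

eventually-≤ : ∀ m → Eventually (m ≤_)
eventually-≤ m = m , λ _ le → le

eventually-all : ∀ {P : ℕ → ℕ → Set} → (∀ i → Eventually (P i)) → ∀ m → Eventually (λ M → ∀ i → i ≤ m → P i M)
eventually-all ev zero    = let B , P = ev 0 in B , λ { M le .0 z≤n → P M le }
eventually-all {P} ev (suc m) = eventually-map₂
  (λ below top i i≤ → case m≤n⇒m<n∨m≡n i≤ of λ { (inj₁ (s≤s le)) → below i le ; (inj₂ refl) → top })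
  (eventually-all ev m) (ev (suc m))

Complete : ∀ {k} → PR k → Vec ℕ k → ℕ → Set
Complete f ms M = ∀ {us v} → Pointwise (Represents M) us ms → Represents M v (eval f ms) → Evaluates (G M) f us v

CompleteAll : ∀ {k l} → Vec (PR k) l → Vec ℕ k → ℕ → Set
CompleteAll gs ms M = ∀ {us} → Pointwise (Represents M) us ms →
  ∃ λ ws → EvaluatesAll (G M) gs us ws × Pointwise (Represents M) ws (evalAll gs ms)

module _ {k} (f : PR k) (g : PR (suc (suc k))) (ms : Vec ℕ k) where

  stage : ℕ → ℕ
  stage i = eval (prec f g) (i ∷ ms)

  -- Completeness of the function that produces the value at stage `i`: `f` at the start, `g`
  -- afterwards.
  CompleteStage : ℕ → ℕ → Set
  CompleteStage zero    = Complete f ms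
  CompleteStage (suc i) = Complete g (i ∷ stage i ∷ ms)

  -- The witness is the pair of vertices tracing the clamped sequence of stages. The guard `Sub i u`
  -- bounds the index of an entry by `m`, where no stage value has been cut off.
  prec-complete : ∀ m {M} → (∀ i → i ≤ m → stage i ≤ M × CompleteStage i M) → Complete (prec f g) (m ∷ ms) M
  prec-complete m {M} stages {u ∷ us} {v} (u∼m ∷ us∼ms) v∼ =
    vert M (p M _) , vert M (q M _) , hTrace⁺ M stage u∼m v∼ , λ i w i≤u t →
      let j , i∼j , w∼ = hTrace⁻ M stage t
          j≤m = represents-sub M i∼j u∼m i≤u
      in justify j i w j≤m i∼j (w∼ (proj₁ (stages j j≤m)))
    where
    justify : ∀ j i w → j ≤ m → Represents M i j → Represents M w (stage j) →
      IsZero (G M) i × Evaluates (G M) f us w ⊎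
      ∃ λ i′ → ∃ λ w′ → IsSucc (G M) i′ i × hTrace M stage i′ w′ × Evaluates (G M) g (i′ ∷ w′ ∷ us) w
    justify zero    i w j≤m i∼j w∼ = inj₁ (represents-zero M i∼j , proj₂ (stages 0 z≤n) us∼ms w∼)
    justify (suc j) i w j≤m i∼j w∼ =
      let j≤m′     = ≤-trans (n≤1+n j) j≤m
          i′ , i′∼ = number M (≤-trans (n≤1+n j) (represents-bound M i∼j))
          w′ , w′∼ = number M (proj₁ (stages j j≤m′))
      in inj₂ (i′ , w′ , represents-succ M i′∼ i∼j , hTrace⁺ M stage i′∼ w′∼ ,
           proj₂ (stages (suc j) j≤m) (i′∼ ∷ w′∼ ∷ us∼ms) (subst (Represents M w) (eval-prec-suc f g ms j) w∼))

-- For fixed arguments only finitely many intermediate values arise, so they all fit into the model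
-- once `M` is large.
complete    : ∀ {k} (f : PR k) ms → Eventually (Complete f ms)
completeAll : ∀ {k l} (gs : Vec (PR k) l) ms → Eventually (CompleteAll gs ms)

complete zer ms = 0 , λ M _ _ v∼ → represents-zero M v∼
complete succ (m ∷ []) = 0 , λ { M _ (u∼ ∷ []) v∼ → represents-succ M u∼ v∼ }
complete (proj i) ms = 0 , λ M _ us∼ v∼ → represents-same M (Pointwise.lookup us∼ i) v∼
complete (comp f gs) ms = eventually-map₂
  {P = CompleteAll gs ms} {Complete f (evalAll gs ms)} {Complete (comp f gs) ms}
  (λ cgs cf us∼ v∼ → let ws , egs , ws∼ = cgs us∼ in ws , egs , cf ws∼ v∼)
  (completeAll gs ms) (complete f (evalAll gs ms))
-- Only the stages up to `m` occur, so finitely many bounds have to be met.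
complete (prec f g) (m ∷ ms) =
  let B , stages = eventually-all
        {P = λ i M → stage f g ms i ≤ M × CompleteStage f g ms i M}
        (λ i → eventually-map₂ {Q = CompleteStage f g ms i} _,_ (eventually-≤ _) (stages i)) m
  in B , λ M le → prec-complete f g ms m (stages M le)
  where
  stages : ∀ i → Eventually (CompleteStage f g ms i)
  stages zero    = complete f ms
  stages (suc i) = complete g (i ∷ stage f g ms i ∷ ms)

completeAll []       ms = 0 , λ M _ _ → [] , tt , []
completeAll (g ∷ gs) ms = eventually-map₂
  {P = λ M → eval g ms ≤ M × Complete g ms M} {CompleteAll gs ms} {CompleteAll (g ∷ gs) ms}
  (λ {M} (le , cg) cgs us∼ →
    let w , w∼ = number M le
        ws , egs , ws∼ = cgs us∼
    in w ∷ ws , (cg us∼ w∼ , egs) , w∼ ∷ ws∼)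
  (eventually-map₂ {Q = Complete g ms} _,_ (eventually-≤ _) (complete g ms)) (completeAll gs ms)

search-complete : ∀ f m t → eval f (m ∷ t ∷ []) ≡ 0 →
  Eventually λ M → ∃ λ u → IsNum (G M) u m × Holds (G M) (u ∷ []) (search f)
search-complete f m t eq = eventually-map₂ {P = λ M → m ≤ M × t ≤ M} {Complete f (m ∷ t ∷ [])}
  (λ {M} (m≤M , t≤M) cf →
    let u , u∼ = number M m≤M
        v , v∼ = number M t≤M
        w , w∼ = number M z≤n
    in u , represents-isNum M m u∼ , v , w ,
       from (Holds-evaluates (G M) f refl refl) (cf (u∼ ∷ v∼ ∷ []) (subst (Represents M w) (sym eq) w∼)) ,
       represents-zero M w∼)
  (eventually-map₂ _,_ (eventually-≤ m) (eventually-≤ t)) (complete f (m ∷ t ∷ []))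

-- The sentence and the 0–1 law

odd≢even : ∀ m k → suc (m + m) ≢ k + k
odd≢even m       (suc k) eq with trans (suc-injective eq) (+-suc k k)
odd≢even (suc m) (suc k) _ | eq = odd≢even m k (trans (sym (+-suc m m)) (suc-injective eq))

noEdges : Formula 0
noEdges = ∀ᶠ ∀ᶠ ¬ᶠ 1F ∼ 0F

sentence : Formula 1 → ℕ → Formula 0
sentence κ e = noEdges ∨ᶠ perfectMatching ∧ᶠ (∃ᶠ numeral e ∧ᶠ κ)

module _ (κ : Formula 1) (e : ℕ) where

  sentenceFm : Fm
  sentenceFm = erase (sentence κ e)

  Witness : ∀ {n} → Graph n → Set
  Witness g = ∃ λ u → IsNum g u e × Holds g (u ∷ []) κ

  ⊨sentence⇔ : ∀ {n} (g : Graph n) → g ⊨T sentenceFm ⇔ (Edgeless g ⊎ Holds g [] perfectMatching × Witness g)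
  ⊨sentence⇔ g = mk⇔
    (λ t → case to (⊨⇔Holds g (sentence κ e)) t of λ where
      (inj₁ el)              → inj₁ el
      (inj₂ (pm , u , h , k)) → inj₂ (pm , u , to (Holds-numeral g e) h , k))
    (λ where
      (inj₁ el)              → from (⊨⇔Holds g (sentence κ e)) (inj₁ el)
      (inj₂ (pm , u , h , k)) → from (⊨⇔Holds g (sentence κ e)) (inj₂ (pm , u , from (Holds-numeral g e) h , k)))

  noWitness-zeroOneLaw : (∀ {n} (g : Graph n) → ¬ Witness g) → ZeroOneLaw sentenceFm
  noWitness-zeroOneLaw none = edgeless-zeroOneLaw sentenceFm λ g → mk⇔
    (λ t → case to (⊨sentence⇔ g) t of λ { (inj₁ el) → el ; (inj₂ (_ , w)) → ⊥-elim (none g w) })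
    (λ el → from (⊨sentence⇔ g) (inj₁ el))

  -- At odd orders the edgeless graph is the only model.
  edgeless-¬tendsToZero : ¬ TendsToZero sentenceFm (erase noEdges)
  edgeless-¬tendsToZero vanishes = <⇒≱ (m<m+n c positive) (begin
    c + c        ≡⟨ cong (c +_) (sym (+-identityʳ c)) ⟩
    2 * c        ≤⟨ proj₂ (vanishes 2 (s≤s z≤n)) n (≤-trans (m≤m+n N N) (n≤1+n (N + N))) ⟩
    count n sentenceFm ≡⟨ count-split n sentenceFm E ⟩
    c + count n (conj sentenceFm (neg E)) ≡⟨ cong (c +_) (count-none (conj sentenceFm (neg E)) none) ⟩
    c + 0        ≡⟨ +-identityʳ c ⟩
    c            ∎)
    where
    open ≤-Reasoning
    E : Fm
    E = erase noEdges
    N n c : ℕ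
    N = proj₁ (vanishes 2 (s≤s z≤n))
    n = suc (N + N)
    c = count n (conj sentenceFm E)
    positive : 0 < c
    positive = count-some (conj sentenceFm E) (emptyGraph n) (from (⊨-conj (emptyGraph n) sentenceFm E)
      (from (⊨sentence⇔ (emptyGraph n)) (inj₁ (emptyGraph-edgeless n)) ,
       from (⊨⇔Holds (emptyGraph n) noEdges) (emptyGraph-edgeless n)))
    impossible : (g : Graph n) → ¬ (g ⊨T E) → ¬ (Edgeless g ⊎ Holds g [] perfectMatching × Witness g)
    impossible g t (inj₁ el)       = t (from (⊨⇔Holds g noEdges) el)
    impossible g t (inj₂ (pm , _)) = let k , eq = perfectMatching-even g pm in odd≢even N k eq
    none : (g : Graph n) → ¬ (g ⊨T conj sentenceFm (neg E))
    none g t =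
      let tφ , t¬E = to (⊨-conj g sentenceFm (neg E)) t in
      impossible g (to (⊨-neg g E) t¬E) (to (⊨sentence⇔ g) tφ)

  -- With `c` counting the models that have edges, there are at most `1 + c` models, and
  -- `1 + c < 3 * c` because `G M` makes `c` positive. The factor 2 would not do, as `c` might be 1.
  edgeless-¬tendsToOne : Eventually (λ M → Witness (G M)) → ¬ TendsToOne sentenceFm (erase noEdges)
  edgeless-¬tendsToOne (B , witnesses) vanishes = <⇒≱ (begin-strict
    count n sentenceFm                ≡⟨ count-split n sentenceFm E ⟩
    count n (conj sentenceFm E) + c   ≤⟨ +-monoˡ-≤ c atMostOne ⟩
    1 + c                    <⟨ +-monoˡ-≤ c (*-monoʳ-≤ 2 positive) ⟩
    2 * c + c                ≡⟨ +-comm (2 * c) c ⟩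
    3 * c                    ∎)
    (proj₂ (vanishes 3 (s≤s z≤n)) n (≤-trans (m≤m⊔n N B) (M≤size M)))
    where
    open ≤-Reasoning
    E : Fm
    E = erase noEdges
    N M n c : ℕ
    N = proj₁ (vanishes 3 (s≤s z≤n))
    -- At least `N` so that the order `size M` is beyond the assumed bound, at least `B` so that a
    -- witness exists.
    M = N ⊔ B
    n = size M
    c = count n (conj sentenceFm (neg E))
    positive : 0 < c
    positive = count-some (conj sentenceFm (neg E)) (G M) (from (⊨-conj (G M) sentenceFm (neg E))
      (from (⊨sentence⇔ (G M)) (inj₂ (hasPerfectMatching M , witnesses M (m≤n⊔m N B))) ,
       from (⊨-neg (G M) E) (λ t → ¬edgeless M (to (⊨⇔Holds (G M) noEdges) t))))
    atMostOne : count n (conj sentenceFm E) ≤ 1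
    atMostOne = count-atMostOne {n} (conj sentenceFm E) λ g h tg th →
      edgeless-unique {n} g h (to (⊨⇔Holds g noEdges) (proj₂ (to (⊨-conj g sentenceFm E) tg)))
                          (to (⊨⇔Holds h noEdges) (proj₂ (to (⊨-conj h sentenceFm E) th)))

  witness-¬zeroOneLaw : Eventually (λ M → Witness (G M)) → ¬ ZeroOneLaw sentenceFm
  witness-¬zeroOneLaw witnesses (_ , law) = case law (erase noEdges) (erase-wellScoped noEdges) of λ where
    (inj₁ tendsToZero) → edgeless-¬tendsToZero tendsToZero
    (inj₂ tendsToOne)  → edgeless-¬tendsToOne witnesses tendsToOne

-- Diagonalisation against an enumeration

open Diagonal (erase noEdges) (erase perfectMatching) (erase {1} (isZero 0F)) (erase {2} (isSucc 0F 1F))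

erase-numeral : ∀ {k} e → erase {suc k} (numeral e) ≡ numeralFm e
erase-numeral zero    = refl
erase-numeral (suc e) = cong (λ φ → ex (conj (erase {2} (isSucc 0F 1F)) φ)) (erase-numeral e)

erase-sentence : ∀ κ e → erase (sentence κ e) ≡ instanceFm (erase κ) e
erase-sentence κ e = cong
  (λ ν → neg (conj (neg (erase noEdges)) (neg (conj (erase perfectMatching) (ex (conj ν (erase κ)))))))
  (erase-numeral e)

Diagonalises : PR 1 → Set
Diagonalises d = ∀ κ → Computes d (code (erase κ) ∷ []) (sentenceFm κ (code (erase κ)))

diagonaliser : ∃ Diagonalises
diagonaliser = diagonalPR , λ κ → diagonal-computes (erase κ) (erase-sentence κ (code (erase κ)))

-- The sentence is a field of its own: comparing concrete codes would unfold astronomical numerals.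
record FixedPoint (R f : PR 2) (θ : ℕ → Fm) : Set where
  field
    e      : ℕ
    ψ      : Fm
    ψ≡     : ψ ≡ θ e
    eval-f : ∀ t → eval f (e ∷ t ∷ []) ≡ eval R (code ψ ∷ t ∷ [])

-- This is `R (d e , t)`. When `e` is the code of the search formula for this very function, `d e`
-- is the code of the resulting sentence, which thus speaks about its own acceptance by `R`.
atDiagonal : PR 2 → PR 1 → PR 2
atDiagonal R d = comp R (comp d (proj 0F ∷ []) ∷ proj 1F ∷ [])

fixedPoint : ∀ R d θ e → Computes d (e ∷ []) (θ e) → FixedPoint R (atDiagonal R d) θ
fixedPoint R d θ e (computes eq) = record
  { e = e ; ψ = θ e ; ψ≡ = refl ; eval-f = λ t → cong (λ x → eval R (x ∷ t ∷ [])) eq }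

-- Acceptance of `ψ` by `R` would give the law, which acceptance also refutes; so `R` never accepts
-- `ψ`. But then `ψ` obeys the law and must be accepted.
¬enumerated : ∀ R ψ → (ZeroOneCodes (code ψ) ⇔ ∃ λ t → eval R (code ψ ∷ t ∷ []) ≡ 0) → Sentence ψ →
  ((∀ t → eval R (code ψ ∷ t ∷ []) ≢ 0) → ZeroOneLaw ψ) →
  (∀ t → eval R (code ψ ∷ t ∷ []) ≡ 0 → ¬ ZeroOneLaw ψ) → ⊥
¬enumerated R ψ enumerates sentence law ¬law =
  let t , eq = to enumerates (ψ , sentence , law never , refl) in never t eq
  where
  never : ∀ t → eval R (code ψ ∷ t ∷ []) ≢ 0
  -- The enumeration only provides some sentence `χ` with the same code, which is `ψ` by injectivity
  -- of `code`.
  never t eq = let χ , _ , law , code≡ = from enumerates (t , eq) in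
    ¬law t eq (subst ZeroOneLaw (code-injective χ ψ code≡) law)

refute : ∀ R f → FixedPoint R f (sentenceFm (search f)) →
  ¬ (∀ x → ZeroOneCodes x ⇔ ∃ λ t → eval R (x ∷ t ∷ []) ≡ 0)
refute R f fp enumerates = ¬enumerated R ψ (enumerates (code ψ))
  (subst Sentence (sym ψ≡) (erase-wellScoped (sentence (search f) e)))
  (λ never → subst ZeroOneLaw (sym ψ≡) (noWitness-zeroOneLaw (search f) e
    (λ g (u , u∼e , h) → let t , eq = search-sound g f u∼e h in never t (trans (sym (eval-f t)) eq))))
  (λ t eq law → witness-¬zeroOneLaw (search f) e (search-complete f e t (trans (eval-f t) eq))
    (subst ZeroOneLaw ψ≡ law))
  where open FixedPoint fp

theorem12 : ¬ RecEnum ZeroOneCodes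
theorem12 (R , enumerates) =
  refute R f
    (fixedPoint R d (sentenceFm (search f)) (code (erase (search f))) (proj₂ diagonaliser (search f)))
    enumerates
  where
  d : PR 1
  d = proj₁ diagonaliser
  f : PR 2
  f = atDiagonal R d
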